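{- Let $K_4^-$ be the $3$-graph on vertex set $\{1,2,3,4\}$ with $3$-edges $123, 124, 134$. For every positive integer $n$, $$\mathrm{co^+ex}(n,K_4^-)=\left\lfloor \frac n3\right\rfloor .$$ Moreover, when $n\equiv 0 \pmod 6$ there are (up to isomorphism) exactly two extremal $n$-vertex $3$-graphs for $K_4^-$, namely the complete balanced $3$-partite $3$-graph on $n$ vertices and the $n$-vertex blow-up of $H_6$ all of whose classes have the same size; when $n\equiv 3\pmod 6$, the unique (up to isomorphism) extremal $n$-vertex $3$-graph for $K_4^-$ is the complete balanced $3$-partite $3$-graph on $n$ vertices.
   Context: An $r$-graph is a finite $r$-uniform hypergraph; an edge is written as the concatenation of its vertices. The minimum positive co-degree $\delta_{r-1}^+(H)$ of a non-empty $r$-graph $H$ is the maximum $k$ such that every $(r-1)$-set of vertices contained in some edge of $H$ is contained in at least $k$ distinct edges of $H$; by convention it is $0$ if $H$ has no edges. A hypergraph is $F$-free if it has no (not necessarily induced) subhypergraph isomorphic to $F$. For an $r$-graph $F$, $\mathrm{co^+ex}(n,F)$ is the maximum of $\delta_{r-1}^+(H)$ over all $n$-vertex $F$-free $r$-graphs $H$. An $n$-vertex $F$-free $r$-graph $H$ is extremal for $F$ if $\delta_{r-1}^+(H)=\mathrm{co^+ex}(n,F)$. The complete balanced $3$-partite $3$-graph on $n$ vertices has its vertex set partitioned into three classes whose sizes differ by at most $1$, and its edges are all triples with exactly one vertex in each class. $H_6$ is the $3$-graph on vertex set $\{1,\dots,6\}$ with edge set $E_6=\{123,124,345,346,561,562,135,146,236,245\}$.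 A blow-up of $H_6$ is a $3$-graph whose vertex set is partitioned as $V_1\cup\dots\cup V_6$ and whose edges are exactly the triples $v_iv_jv_k$ with $v_i\in V_i$, $v_j\in V_j$, $v_k\in V_k$ and $ijk\in E_6$. -}

module Defs where

open import Data.Bool.Properties using () renaming (_≟_ to _≟ᵇ_)
open import Data.Fin.Base using (Fin)
open import Data.Fin.Patterns using (0F; 1F; 2F; 3F; 4F; 5F)
open import Data.Fin.Properties using (_≟_; any?)
open import Data.Fin.Subset using (Subset; _∈_; _⊆_; _∩_; _∪_; ⁅_⁆; ∣_∣)
open import Data.Fin.Subset.Properties using (_∈?_)
open import Data.List.Base using (List; []; _∷_)
open import Data.List.Membership.Propositional using () renaming (_∈_ to _∈ˡ_)
open import Data.List.Relation.Unary.All using (all?; lookup)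
open import Data.Nat.Base using (ℕ; suc; _≤_)
open import Data.Nat.Properties using () renaming (_≟_ to _≟ⁿ_)
open import Data.Product.Base using (Σ-syntax; ∃-syntax; _×_)
open import Data.Sum.Base using (_⊎_)
open import Data.Vec.Base using (tabulate)
open import Data.Vec.Properties using (≡-dec)
open import Function.Bundles using (_⇔_; _↔_; Inverse)
open import Function.Definitions using (Injective)
open import Level using (Level; 0ℓ)
open import Relation.Binary.PropositionalEquality using (_≡_)
open import Relation.Nullary.Decidable using (does; True; toWitness; _×-dec_)
open import Relation.Nullary.Negation using (¬_)
open import Relation.Unary using (Pred; Decidable)

import Data.List.Membership.DecPropositional as DecMembership

private
  variable
    ℓ : Level
    m n r : ℕ

IsMaximum : Pred ℕ ℓ → Pred ℕ ℓ
IsMaximum P k = P k × (∀ j → P j → j ≤ k)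

image : (Fin n → Fin m) → Subset n → Subset m
image f S = tabulate λ j → does (any? λ i → (i ∈? S) ×-dec (f i ≟ j))

triple : Fin n → Fin n → Fin n → Subset n
triple u v w = ⁅ u ⁆ ∪ ⁅ v ⁆ ∪ ⁅ w ⁆

-- An r-graph with vertex set Fin n.
record Hypergraph (r n : ℕ) : Set₁ where
  field
    Edge    : Pred (Subset n) 0ℓ
    edge?   : Decidable Edge
    uniform : ∀ {e} → Edge e → ∣ e ∣ ≡ r

open Hypergraph public

fromEdges : (es : List (Subset n)) →
            {True (all? (λ e → ∣ e ∣ ≟ⁿ r) es)} → Hypergraph r n
fromEdges es {ok} = record
  { Edge    = _∈ˡ es
  ; edge?   = λ e → DecMembership._∈?_ (≡-dec _≟ᵇ_) e es
  ; uniform = lookup (toWitness ok)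
  }

infix 4 _≅_

_≅_ : Hypergraph r n → Hypergraph r m → Set
_≅_ {n = n} {m = m} G H =
  Σ[ φ ∈ Fin n ↔ Fin m ] (∀ e → Edge G e ⇔ Edge H (image (Inverse.to φ) e))

-- A not necessarily induced copy of F in H.
Contains : Hypergraph r m → Hypergraph r n → Set
Contains {m = m} {n = n} F H =
  Σ[ f ∈ (Fin m → Fin n) ]
    (Injective _≡_ _≡_ f × (∀ e → Edge F e → Edge H (image f e)))

Free : Hypergraph r m → Hypergraph r n → Set
Free F H = ¬ Contains F H

InAtLeast : Hypergraph r n → Subset n → ℕ → Set
InAtLeast {n = n} H S k =
  Σ[ f ∈ (Fin k → Subset n) ]
    (Injective _≡_ _≡_ f × (∀ i → Edge H (f i) × S ⊆ f i))

-- The condition suc ∣ S ∣ ≡ r says that S is an (r-1)-set.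
PositiveCodegree≥ : Hypergraph r n → ℕ → Set
PositiveCodegree≥ {r = r} H k =
  ∀ S → suc ∣ S ∣ ≡ r → (∃[ e ] (Edge H e × S ⊆ e)) → InAtLeast H S k

-- Isδ⁺ H k says that k is the minimum positive co-degree of H. Without edges
-- every k satisfies PositiveCodegree≥ vacuously, hence the separate convention.
Isδ⁺ : Hypergraph r n → ℕ → Set
Isδ⁺ H k =
    ((∃[ e ] Edge H e) × IsMaximum (PositiveCodegree≥ H) k)
  ⊎ (¬ (∃[ e ] Edge H e) × k ≡ 0)

-- IsCo⁺ex n F k says that co⁺ex(n,F) = k.
IsCo⁺ex : ℕ → Hypergraph r m → ℕ → Set₁
IsCo⁺ex {r = r} n F =
  IsMaximum λ k → Σ[ H ∈ Hypergraph r n ] (Free F H × Isδ⁺ H k)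

Extremal : Hypergraph r m → Hypergraph r n → Set₁
Extremal {n = n} F H = Free F H × ∃[ k ] (IsCo⁺ex n F k × Isδ⁺ H k)

-- A partition of Fin n into m labelled, possibly empty, classes is given by
-- the map c sending each vertex to the index of its class.
class : (Fin n → Fin m) → Fin m → Subset n
class c i = tabulate λ v → does (c v ≟ i)

IsCompleteBalanced3Partite : Hypergraph 3 n → Set
IsCompleteBalanced3Partite {n = n} H =
  Σ[ c ∈ (Fin n → Fin 3) ]
    ( (∀ i j → ∣ class c i ∣ ≤ suc ∣ class c j ∣)
    × (∀ S → Edge H S ⇔ (∣ S ∣ ≡ 3 × (∀ i → ∣ S ∩ class c i ∣ ≡ 1))))

IsBlowUpAlong : Hypergraph 3 m → (Fin n → Fin m) → Hypergraph 3 n → Set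
IsBlowUpAlong F c H =
  ∀ S → Edge H S ⇔
    (∃[ u ] ∃[ v ] ∃[ w ]
      (S ≡ triple u v w × Edge F (triple (c u) (c v) (c w))))

IsEqualClassBlowUp : Hypergraph 3 m → Hypergraph 3 n → Set
IsEqualClassBlowUp {m = m} {n = n} F H =
  Σ[ c ∈ (Fin n → Fin m) ]
    ((∀ i j → ∣ class c i ∣ ≡ ∣ class c j ∣) × IsBlowUpAlong F c H)

-- Vertices are numbered from 0: these are the edges 123, 124, 134.
K₄⁻ : Hypergraph 3 4
K₄⁻ = fromEdges
  ( triple 0F 1F 2F ∷ triple 0F 1F 3F ∷ triple 0F 2F 3F ∷ [] )

-- Numbered from 0 again: 123, 124, 345, 346, 561, 562, 135, 146, 236, 245.
H₆ : Hypergraph 3 6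
H₆ = fromEdges
  ( triple 0F 1F 2F ∷ triple 0F 1F 3F
  ∷ triple 2F 3F 4F ∷ triple 2F 3F 5F
  ∷ triple 4F 5F 0F ∷ triple 4F 5F 1F
  ∷ triple 0F 2F 4F ∷ triple 0F 3F 5F
  ∷ triple 1F 2F 5F ∷ triple 1F 3F 4F ∷ [] )

{-# OPTIONS --safe #-}

-- In a K₄⁻-free 3-graph the common neighbourhoods of the three pairs of an edge are disjoint,
-- so 3 δ⁺ ≤ n. If 3 δ⁺ = n, they partition the vertices: every quadruple spans zero or two
-- edges. Hence the edge indicator is a 2-cocycle over 𝔽₂, and two vertices in no common edge
-- are twins. Either the 3-graph is a blow-up of one edge, or it contains five edges that are
-- the consecutive triples of a 5-cycle p₀ … p₄. In the latter case N(p₀p₁) is the symmetric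
-- difference of N(p₀p₃) and N(p₁p₃); as all three have size δ⁺, the last two meet, and a common
-- vertex completes the 5-cycle to a copy of H₆. Every vertex is a twin of a vertex of this copy,
-- and regularity of the codegrees makes the classes equal.
module Submission where

open import Defs
open import Data.Bool.Base using (Bool; true; false; _∨_; _xor_; if_then_else_)
open import Data.Bool.Properties using (¬-not; ⇔→≡) renaming (_≟_ to _≟ᵇ_)
open import Data.Empty using (⊥; ⊥-elim)
open import Data.Fin.Base using (Fin; zero; suc; inject≤; punchIn)
open import Data.Fin.Patterns using (0F; 1F; 2F; 3F; 4F; 5F)
open import Data.Fin.Permutation
  using (Permutation; _⟨$⟩ʳ_; _⟨$⟩ˡ_; inverseˡ; inverseʳ; id; insert; insert-punchIn)
open import Data.Fin.Properties using (_≟_; any?; all?; suc-injective; inject≤-injective; pigeonhole; <⇒≢)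
open import Data.Fin.Subset
  using (Subset; inside; outside; _∈_; _∉_; _⊆_; _∪_; _∩_; _-_; ⁅_⁆; ∣_∣; Nonempty; ⊤)
  renaming (⊥ to ∅)
open import Data.Fin.Subset.Properties
  using ( x∈⁅x⁆; x∈⁅y⁆⇒x≡y; x∈p∪q⁺; x∈p∪q⁻; x∈p∩q⁺; x∈p∩q⁻; ⊆-antisym
        ; ∪-identityˡ; ∪-identityʳ; ∪-idem
        ; ∪-comm; ∪-assoc; ∈⊤; _∈?_; drop-there; x∈p∧x≢y⇒x∈p-y; ∣⁅x⁆∣≡1; ∣p∣≤n; ∣p∣≡n⇒p≡⊤; p⊆q⇒∣p∣≤∣q∣; x∈p⇒∣p-x∣<∣p∣)
open import Data.List.Relation.Unary.All using ([]; _∷_) renaming (lookup to lookupᴬ)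
open import Data.List.Base using ([]; _∷_)
open import Data.List.Relation.Unary.Any using (here; there)
open import Data.Nat.Base using (ℕ; zero; suc; _≤_; _<_; _+_; _*_; z≤n; s≤s)
open import Data.Nat.DivMod using (_/_; _%_; m≡m%n+[m/n]*n; m*n%n≡0; m*n/n≡m; /-monoˡ-≤; m<n*o⇒m/o<n)
open import Data.Nat.Properties
  using ( _≤?_; ≤-refl; ≤-reflexive; ≤-trans; ≤-antisym; ≤-pred; ≤⇒≯; m≤m+n; +-suc; +-identityʳ
        ; +-0-commutativeMonoid; +-mono-≤; +-monoˡ-≤; +-monoʳ-≤; +-cancelˡ-≤; +-cancelʳ-≤; +-cancelˡ-≡; +-cancelʳ-≡
        ; *-comm; *-cancelˡ-≡)
  renaming (_≟_ to _≟ⁿ_; suc-injective to suc-injectiveⁿ)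
open import Data.Nat.Solver using (module +-*-Solver)
open import Data.Product.Base using (Σ-syntax; ∃-syntax; _×_; _,_; proj₁; proj₂)
open import Data.Sum.Base using (_⊎_; inj₁; inj₂; [_,_]′)
open import Data.Vec.Base using ([]; _∷_; tabulate; lookup; here; there)
open import Data.Vec.Properties using (lookup∘tabulate; lookup⇒[]=; []=⇒lookup; tabulate-cong; ≡-dec)
open import Data.Vec.Relation.Unary.All using ([]; _∷_)
open import Data.Vec.Relation.Unary.AllPairs using ([]; _∷_)
open import Data.Vec.Relation.Unary.Unique.Propositional.Properties using (lookup-injective)
open import Function.Base using (_∘_) renaming (id to idᶠ)
open import Function.Bundles using (_⇔_; Inverse; Equivalence; mk⇔)
open import Function.Definitions using (Injective)
open import Relation.Binary.PropositionalEquality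
  using (_≡_; _≢_; refl; sym; trans; cong; cong₂; subst; subst₂; module ≡-Reasoning)
open import Relation.Nullary.Decidable
  using (Dec; yes; no; does; dec-true; map′; from-yes; ¬?; _×-dec_; _⊎-dec_; _→-dec_)
open import Relation.Nullary.Negation using (¬_; contradiction)

open import Algebra.Properties.CommutativeMonoid.Sum +-0-commutativeMonoid
  using (sum; sum-cong-≗; sum-replicate-zero; ∑-distrib-+)
open +-*-Solver using (solve; _:+_; _:*_; _:=_; con)

-- Each vertex of an edge lies in the common neighbourhood of the other two, so the three
-- neighbourhoods contain the edge and can fill the whole vertex set; equality `n = 3k` is
-- attainable for this reason. A 3-graph whose quadruples all span an even number of edges is a
-- two-graph, and `H₆` is the regular two-graph on six vertices: every pair lies in exactly two
-- edges and every vertex has a 5-cycle as its link. Its blow-up with classes of size `s` therefore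
-- has all positive codegrees equal to `2s`, a third of `6s`, and it competes with the tripartite
-- 3-graph only when 6 divides `n`. The dichotomy asks whether two common neighbours of some pair
-- lie together in an edge. If this never happens, common neighbours are twins and a single edge
-- represents all classes; if it happens, the cocycle condition closes up a 5-cycle. The cocycle
-- condition also makes the last stage finite: five bits determine how a vertex attaches to a copy
-- of `H₆`.

private
  variable
    k m n : ℕ
    u v w x y : Fin n
    S : Subset n

-- Subsets, images and triples.

does⁻ : ∀ {a} {A : Set a} (A? : Dec A) → does A? ≡ true → A
does⁻ (yes a) _ = a

false≢true : ∀ {b} → b ≡ false → b ≡ true → ∀ {a} {A : Set a} → A
false≢true refl ()

∈-tabulate⁺ : (P : Fin n → Bool) → P x ≡ true → x ∈ tabulate P
∈-tabulate⁺ {x = x} P Px = lookup⇒[]= x (tabulate P) (trans (lookup∘tabulate P x) Px)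

∈-tabulate⁻ : (P : Fin n → Bool) → x ∈ tabulate P → P x ≡ true
∈-tabulate⁻ {x = x} P x∈ = trans (sym (lookup∘tabulate P x)) ([]=⇒lookup x∈)

∈-image⁺ : (f : Fin n → Fin m) → x ∈ S → f x ∈ image f S
∈-image⁺ {x = x} {S = S} f x∈S = ∈-tabulate⁺ _
  (dec-true (any? λ i → (i ∈? S) ×-dec (f i ≟ f x)) (x , x∈S , refl))

∈-image⁻ : (f : Fin n → Fin m) → y ∈ image f S → ∃[ x ] (x ∈ S × f x ≡ y)
∈-image⁻ {y = y} {S = S} f y∈ =
  does⁻ (any? λ i → (i ∈? S) ×-dec (f i ≟ y)) (∈-tabulate⁻ _ y∈)

∈-class⁺ : (c : Fin n → Fin m) → c x ≡ y → x ∈ class c y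
∈-class⁺ {x = x} {y = y} c eq = ∈-tabulate⁺ _ (dec-true (c x ≟ y) eq)

∈-class⁻ : (c : Fin n → Fin m) → x ∈ class c y → c x ≡ y
∈-class⁻ {x = x} {y = y} c x∈ = does⁻ (c x ≟ y) (∈-tabulate⁻ _ x∈)

∈-triple⁻ : x ∈ triple u v w → x ≡ u ⊎ x ≡ v ⊎ x ≡ w
∈-triple⁻ {u = u} {v} {w} x∈ with x∈p∪q⁻ ⁅ u ⁆ _ x∈
... | inj₁ x∈u = inj₁ (x∈⁅y⁆⇒x≡y u x∈u)
... | inj₂ x∈vw with x∈p∪q⁻ ⁅ v ⁆ ⁅ w ⁆ x∈vw
...   | inj₁ x∈v = inj₂ (inj₁ (x∈⁅y⁆⇒x≡y v x∈v))
...   | inj₂ x∈w = inj₂ (inj₂ (x∈⁅y⁆⇒x≡y w x∈w))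

triple∋₁ : (u v w : Fin n) → u ∈ triple u v w
triple∋₁ u v w = x∈p∪q⁺ (inj₁ (x∈⁅x⁆ u))

triple∋₂ : (u v w : Fin n) → v ∈ triple u v w
triple∋₂ u v w = x∈p∪q⁺ (inj₂ (x∈p∪q⁺ (inj₁ (x∈⁅x⁆ v))))

triple∋₃ : (u v w : Fin n) → w ∈ triple u v w
triple∋₃ u v w = x∈p∪q⁺ (inj₂ (x∈p∪q⁺ (inj₂ (x∈⁅x⁆ w))))

triple⊆ : u ∈ S → v ∈ S → w ∈ S → triple u v w ⊆ S
triple⊆ u∈ v∈ w∈ x∈ with ∈-triple⁻ x∈
... | inj₁ refl = u∈
... | inj₂ (inj₁ refl) = v∈
... | inj₂ (inj₂ refl) = w∈

triple-swap₁₂ : (u v w : Fin n) → triple u v w ≡ triple v u w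
triple-swap₁₂ u v w = ⊆-antisym
  (triple⊆ (triple∋₂ v u w) (triple∋₁ v u w) (triple∋₃ v u w))
  (triple⊆ (triple∋₂ u v w) (triple∋₁ u v w) (triple∋₃ u v w))

triple-swap₂₃ : (u v w : Fin n) → triple u v w ≡ triple u w v
triple-swap₂₃ u v w = cong (⁅ u ⁆ ∪_) (∪-comm ⁅ v ⁆ ⁅ w ⁆)

image-triple : (f : Fin n → Fin m) (u v w : Fin n) →
               image f (triple u v w) ≡ triple (f u) (f v) (f w)
image-triple f u v w = ⊆-antisym to
  (triple⊆ (∈-image⁺ f (triple∋₁ u v w)) (∈-image⁺ f (triple∋₂ u v w)) (∈-image⁺ f (triple∋₃ u v w)))
  where
  to : image f (triple u v w) ⊆ triple (f u) (f v) (f w)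
  to y∈ with ∈-image⁻ f y∈
  ... | x , x∈ , refl with ∈-triple⁻ x∈
  ...   | inj₁ refl = triple∋₁ (f u) (f v) (f w)
  ...   | inj₂ (inj₁ refl) = triple∋₂ (f u) (f v) (f w)
  ...   | inj₂ (inj₂ refl) = triple∋₃ (f u) (f v) (f w)

∣⁅x⁆∪S∣ : x ∉ S → ∣ ⁅ x ⁆ ∪ S ∣ ≡ suc ∣ S ∣
∣⁅x⁆∪S∣ {x = zero}  {S = outside ∷ S} _ = cong (suc ∘ ∣_∣) (∪-identityˡ S)
∣⁅x⁆∪S∣ {x = zero}  {S = inside ∷ S} x∉ = contradiction here x∉
∣⁅x⁆∪S∣ {x = suc x} {S = outside ∷ S} x∉ = ∣⁅x⁆∪S∣ (x∉ ∘ there)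
∣⁅x⁆∪S∣ {x = suc x} {S = inside ∷ S} x∉ = cong suc (∣⁅x⁆∪S∣ (x∉ ∘ there))

split : x ∈ S → ∃[ S′ ] (x ∉ S′ × S ≡ ⁅ x ⁆ ∪ S′)
split {S = _ ∷ S} here = outside ∷ S , (λ ()) , cong (inside ∷_) (sym (∪-identityˡ S))
split {S = s ∷ _} (there x∈S) with split x∈S
... | S′ , x∉S′ , eq = s ∷ S′ , x∉S′ ∘ drop-there , cong (s ∷_) eq

∣S∣≡suc⇒Nonempty : ∣ S ∣ ≡ suc k → Nonempty S
∣S∣≡suc⇒Nonempty {S = inside ∷ S} _ = zero , here
∣S∣≡suc⇒Nonempty {S = outside ∷ S} eq with ∣S∣≡suc⇒Nonempty {S = S} eq
... | x , x∈S = suc x , there x∈S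

split-size : ∣ S ∣ ≡ suc k → x ∈ S → ∃[ S′ ] (∣ S′ ∣ ≡ k × x ∉ S′ × S ≡ ⁅ x ⁆ ∪ S′)
split-size size x∈S with split x∈S
... | S′ , x∉S′ , refl = S′ , suc-injectiveⁿ (trans (sym (∣⁅x⁆∪S∣ x∉S′)) size) , x∉S′ , refl

∣S∣≡0⇒S≡∅ : ∣ S ∣ ≡ 0 → S ≡ ∅
∣S∣≡0⇒S≡∅ {S = []} _ = refl
∣S∣≡0⇒S≡∅ {S = outside ∷ S} eq = cong (outside ∷_) (∣S∣≡0⇒S≡∅ {S = S} eq)

∣S∣≡1⇒S≡⁅x⁆ : ∣ S ∣ ≡ 1 → ∃[ x ] S ≡ ⁅ x ⁆
∣S∣≡1⇒S≡⁅x⁆ {S = S} size with ∣S∣≡suc⇒Nonempty {S = S} size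
... | x , x∈S with split-size {S = S} size x∈S
... | S′ , size′ , _ , refl = x , trans (cong (⁅ x ⁆ ∪_) (∣S∣≡0⇒S≡∅ {S = S′} size′)) (∪-identityʳ ⁅ x ⁆)

∣S∣≡2⇒S≡pair : ∣ S ∣ ≡ 2 → ∃[ u ] ∃[ v ] (u ≢ v × S ≡ ⁅ u ⁆ ∪ ⁅ v ⁆)
∣S∣≡2⇒S≡pair {S = S} size with ∣S∣≡suc⇒Nonempty {S = S} size
... | u , u∈S with split-size {S = S} size u∈S
... | S′ , size′ , u∉ , refl with ∣S∣≡1⇒S≡⁅x⁆ {S = S′} size′
... | v , refl = u , v , (λ { refl → u∉ (x∈⁅x⁆ u) }) , refl

∣S∣≡3⇒S≡triple-with : ∣ S ∣ ≡ 3 → u ∈ S → v ∈ S → u ≢ v → ∃[ w ] S ≡ triple u v w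
∣S∣≡3⇒S≡triple-with {u = u} size u∈ v∈ u≢v with split-size size u∈
... | S′ , size′ , _ , refl with x∈p∪q⁻ ⁅ u ⁆ S′ v∈
... | inj₁ v∈u = contradiction (sym (x∈⁅y⁆⇒x≡y u v∈u)) u≢v
... | inj₂ v∈S′ with split-size {S = S′} size′ v∈S′
... | S″ , size″ , _ , refl with ∣S∣≡1⇒S≡⁅x⁆ {S = S″} size″
... | w , refl = w , refl

∣S∣≡3⇒S≡triple : ∣ S ∣ ≡ 3 → ∃[ u ] ∃[ v ] ∃[ w ] S ≡ triple u v w
∣S∣≡3⇒S≡triple {S = S} size with ∣S∣≡suc⇒Nonempty {S = S} size
... | u , u∈S with split-size {S = S} size u∈S
... | S′ , size′ , u∉ , refl with ∣S∣≡2⇒S≡pair {S = S′} size′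
... | v , w , _ , refl = u , v , w , refl

∣⁅u⁆∪⁅v⁆∣ : u ≢ v → ∣ ⁅ u ⁆ ∪ ⁅ v ⁆ ∣ ≡ 2
∣⁅u⁆∪⁅v⁆∣ {v = v} u≢v = trans (∣⁅x⁆∪S∣ (u≢v ∘ x∈⁅y⁆⇒x≡y v)) (cong suc (∣⁅x⁆∣≡1 v))

∣triple∣ : u ≢ v → u ≢ w → v ≢ w → ∣ triple u v w ∣ ≡ 3
∣triple∣ {u = u} {v} {w} u≢v u≢w v≢w = trans (∣⁅x⁆∪S∣ u∉) (cong suc (∣⁅u⁆∪⁅v⁆∣ v≢w))
  where
  u∉ : u ∉ ⁅ v ⁆ ∪ ⁅ w ⁆
  u∉ u∈ with x∈p∪q⁻ ⁅ v ⁆ ⁅ w ⁆ u∈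
  ... | inj₁ u∈v = u≢v (x∈⁅y⁆⇒x≡y v u∈v)
  ... | inj₂ u∈w = u≢w (x∈⁅y⁆⇒x≡y w u∈w)

∣triple-uuw∣≢3 : (u w : Fin n) → ∣ triple u u w ∣ ≢ 3
∣triple-uuw∣≢3 u w size = pair≢3 (trans (cong ∣_∣ (sym collapse)) size)
  where
  collapse : triple u u w ≡ ⁅ u ⁆ ∪ ⁅ w ⁆
  collapse = trans (sym (∪-assoc ⁅ u ⁆ ⁅ u ⁆ ⁅ w ⁆)) (cong (_∪ ⁅ w ⁆) (∪-idem ⁅ u ⁆))
  pair≢3 : ∣ ⁅ u ⁆ ∪ ⁅ w ⁆ ∣ ≢ 3
  pair≢3 eq with u ≟ w
  ... | no u≢w = contradiction (trans (sym (∣⁅u⁆∪⁅v⁆∣ u≢w)) eq) λ ()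
  ... | yes refl = contradiction (trans (sym (trans (cong ∣_∣ (∪-idem ⁅ u ⁆)) (∣⁅x⁆∣≡1 u))) eq) λ ()

-- Counting.

-- # (λ v → does (c v ≟ i)) is definitionally ∣ class c i ∣.
# : (Fin n → Bool) → ℕ
# P = ∣ tabulate P ∣

#-cong : {P Q : Fin n → Bool} → (∀ x → P x ≡ Q x) → # P ≡ # Q
#-cong P≗Q = cong ∣_∣ (tabulate-cong P≗Q)

#-∨ : (P Q : Fin n → Bool) → (∀ x → P x ≡ true → Q x ≡ true → ⊥) →
      # (λ x → P x ∨ Q x) ≡ # P + # Q
#-∨ {zero} P Q disj = refl
#-∨ {suc n} P Q disj with P zero in p | Q zero in q | #-∨ (P ∘ suc) (Q ∘ suc) (disj ∘ suc)
... | true  | true  | _  = ⊥-elim (disj zero p q)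
... | true  | false | ih = cong suc ih
... | false | true  | ih = trans (cong suc ih) (sym (+-suc _ _))
... | false | false | ih = ih

#≡n⇒all : (P : Fin n → Bool) → # P ≡ n → ∀ x → P x ≡ true
#≡n⇒all P eq x = ∈-tabulate⁻ P (subst (x ∈_) (sym (∣p∣≡n⇒p≡⊤ eq)) ∈⊤)

elements : (S : Subset n) → Σ[ f ∈ (Fin ∣ S ∣ → Fin n) ] (Injective _≡_ _≡_ f × (∀ i → f i ∈ S))
elements [] = (λ ()) , (λ { {()} }) , λ ()
elements (outside ∷ S) with elements S
... | f , f-inj , f∈ = suc ∘ f , f-inj ∘ suc-injective , there ∘ f∈
elements (inside ∷ S) with elements S
... | f , f-inj , f∈ = g , g-inj , g∈
  where
  g : Fin (suc ∣ S ∣) → Fin _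
  g zero = zero
  g (suc i) = suc (f i)
  g-inj : Injective _≡_ _≡_ g
  g-inj {zero} {zero} _ = refl
  g-inj {suc i} {suc j} eq = cong suc (f-inj (suc-injective eq))
  g∈ : ∀ i → g i ∈ inside ∷ S
  g∈ zero = here
  g∈ (suc i) = there (f∈ i)

injection⇒≤∣S∣ : (S : Subset n) (f : Fin k → Fin n) → Injective _≡_ _≡_ f → (∀ i → f i ∈ S) → k ≤ ∣ S ∣
injection⇒≤∣S∣ {k = zero} S f f-inj f∈ = z≤n
injection⇒≤∣S∣ {k = suc k} S f f-inj f∈ = ≤-trans
  (s≤s (injection⇒≤∣S∣ (S - f zero) (f ∘ suc) (suc-injective ∘ f-inj)
    λ i → x∈p∧x≢y⇒x∈p-y (f∈ (suc i)) λ eq → contradiction (f-inj {suc i} {zero} eq) λ ()))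
  (x∈p⇒∣p-x∣<∣p∣ (f∈ zero))

#-∘ : (P : Fin n → Bool) (f : Fin m → Fin n) → Injective _≡_ _≡_ f → # (P ∘ f) ≤ # P
#-∘ P f f-inj with elements (tabulate (P ∘ f))
... | g , g-inj , g∈ = injection⇒≤∣S∣ _ (f ∘ g) (g-inj ∘ f-inj) λ i → ∈-tabulate⁺ P (∈-tabulate⁻ (P ∘ f) (g∈ i))

-- Edge indicators, freeness and codegrees.

module _ (H : Hypergraph 3 n) where

  opaque
    -- A Boolean function of ordered triples lets the cocycle condition be an identity of `xor`;
    -- degenerate triples get `false` by uniformity. It is unfolded again only for the finite checks
    -- on `K₃³` and `H₆`.
    adj : Fin n → Fin n → Fin n → Bool
    adj u v w = does (edge? H (triple u v w))

    adj⁺ : Edge H (triple u v w) → adj u v w ≡ true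
    adj⁺ = dec-true (edge? H _)

    adj⁻ : adj u v w ≡ true → Edge H (triple u v w)
    adj⁻ = does⁻ (edge? H _)

    adj-swap₁₂ : ∀ u v w → adj u v w ≡ adj v u w
    adj-swap₁₂ u v w = cong (does ∘ edge? H) (triple-swap₁₂ u v w)

    adj-swap₂₃ : ∀ u v w → adj u v w ≡ adj u w v
    adj-swap₂₃ u v w = cong (does ∘ edge? H) (triple-swap₂₃ u v w)

  adj-uuw : ∀ u w → adj u u w ≡ false
  adj-uuw u w = ¬-not λ eq → ∣triple-uuw∣≢3 u w (uniform H (adj⁻ eq))

  adj⇒u≢v : adj u v w ≡ true → u ≢ v
  adj⇒u≢v {u} {w = w} eq refl = false≢true (adj-uuw u w) eq

  adj⇒v≢w : adj u v w ≡ true → v ≢ w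
  adj⇒v≢w {u} {v} {w} eq = adj⇒u≢v {w = u} (trans (trans (adj-swap₂₃ v w u) (adj-swap₁₂ v u w)) eq)

  adj⇒u≢w : adj u v w ≡ true → u ≢ w
  adj⇒u≢w {u} {v} {w} eq = adj⇒u≢v {w = v} (trans (adj-swap₂₃ u w v) eq)

  -- `a` is the vertex common to the three edges. The vertices of an edge are distinct, so three
  -- such edges force an injective copy.
  K₄⁻-free : Set
  K₄⁻-free = ∀ a b c d → adj a b c ≡ true → adj a b d ≡ true → adj a c d ≡ false

  CodegreesAtLeast : ℕ → Set
  CodegreesAtLeast k = ∀ {u v w} → adj u v w ≡ true → k ≤ # (adj u v)

  Free⇒K₄⁻-free : Free K₄⁻ H → K₄⁻-free
  Free⇒K₄⁻-free free a b c d abc abd = ¬-not λ acd → free (K₄⁻-copy acd)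
    where
    K₄⁻-copy : adj a c d ≡ true → Contains K₄⁻ H
    K₄⁻-copy acd = f , f-inj _ _ , edges
      where
      f : Fin 4 → Fin n
      f = lookup (a ∷ b ∷ c ∷ d ∷ [])
      f-inj : ∀ i j → f i ≡ f j → i ≡ j
      f-inj = lookup-injective
        ( (adj⇒u≢v abc ∷ adj⇒u≢w abc ∷ adj⇒u≢w abd ∷ []) ∷ (adj⇒v≢w abc ∷ adj⇒v≢w abd ∷ [])
        ∷ (adj⇒v≢w acd ∷ []) ∷ [] ∷ [])
      edges : ∀ e → Edge K₄⁻ e → Edge H (image f e)
      edges _ (here refl) = subst (Edge H) (sym (image-triple f 0F 1F 2F)) (adj⁻ abc)
      edges _ (there (here refl)) = subst (Edge H) (sym (image-triple f 0F 1F 3F)) (adj⁻ abd)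
      edges _ (there (there (here refl))) = subst (Edge H) (sym (image-triple f 0F 2F 3F)) (adj⁻ acd)

  K₄⁻-free⇒Free : K₄⁻-free → Free K₄⁻ H
  K₄⁻-free⇒Free free (f , _ , edges) =
    false≢true (free _ _ _ _ (edge 0F 1F 2F (here refl)) (edge 0F 1F 3F (there (here refl))))
               (edge 0F 2F 3F (there (there (here refl))))
    where
    edge : ∀ i j l → Edge K₄⁻ (triple i j l) → adj (f i) (f j) (f l) ≡ true
    edge i j l e = adj⁺ (subst (Edge H) (image-triple f i j l) (edges _ e))

  third-vertex-injective : adj u v x ≡ true → triple u v x ≡ triple u v y → x ≡ y
  third-vertex-injective {u} {v} {x} {y} uvx eq
    with ∈-triple⁻ {u = u} {v} {y} (subst (x ∈_) eq (triple∋₃ u v x))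
  ... | inj₁ x≡u = contradiction (sym x≡u) (adj⇒u≢w uvx)
  ... | inj₂ (inj₁ x≡v) = contradiction (sym x≡v) (adj⇒v≢w uvx)
  ... | inj₂ (inj₂ x≡y) = x≡y

  -- An edge through `u` and `v` is determined by its third vertex, so distinct edges over the pair
  -- give distinct common neighbours.
  codegrees⁺ : PositiveCodegree≥ H k → CodegreesAtLeast k
  codegrees⁺ δ {u} {v} {w} uvw
    with δ (⁅ u ⁆ ∪ ⁅ v ⁆) (cong suc (∣⁅u⁆∪⁅v⁆∣ (adj⇒u≢v uvw)))
           (triple u v w , adj⁻ uvw , λ x∈ → subst (_ ∈_) (∪-assoc ⁅ u ⁆ ⁅ v ⁆ ⁅ w ⁆) (x∈p∪q⁺ (inj₁ x∈)))
  ... | f , f-inj , f-edge = injection⇒≤∣S∣ _ g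
        (λ {i} {j} eq → f-inj (trans (proj₂ (third i)) (trans (cong (triple u v) eq) (sym (proj₂ (third j))))))
        λ i → ∈-tabulate⁺ (adj u v) (adj⁺ (subst (Edge H) (proj₂ (third i)) (proj₁ (f-edge i))))
    where
    third : ∀ i → ∃[ w′ ] f i ≡ triple u v w′
    third i = ∣S∣≡3⇒S≡triple-with (uniform H (proj₁ (f-edge i)))
      (proj₂ (f-edge i) (x∈p∪q⁺ (inj₁ (x∈⁅x⁆ u)))) (proj₂ (f-edge i) (x∈p∪q⁺ (inj₂ (x∈⁅x⁆ v))))
      (adj⇒u≢v uvw)
    g : Fin _ → Fin n
    g = proj₁ ∘ third

  codegrees⁻ : CodegreesAtLeast k → PositiveCodegree≥ H k
  codegrees⁻ {k} codeg S size (e , e∈H , S⊆e) with ∣S∣≡2⇒S≡pair {S = S} (suc-injectiveⁿ size)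
  ... | u , v , u≢v , refl
    with ∣S∣≡3⇒S≡triple-with {S = e} (uniform H e∈H)
           (S⊆e (x∈p∪q⁺ (inj₁ (x∈⁅x⁆ u)))) (S⊆e (x∈p∪q⁺ (inj₂ (x∈⁅x⁆ v)))) u≢v
  ... | w , refl with elements (tabulate (adj u v))
  ... | g , g-inj , g∈ = triple u v ∘ g ∘ ι
      , (λ {i} eq → inject≤-injective k≤ k≤ _ _ (g-inj (third-vertex-injective (uvg (ι i)) eq)))
      , λ i → adj⁻ (uvg (ι i)) , λ x∈ → subst (_ ∈_) (∪-assoc ⁅ u ⁆ ⁅ v ⁆ ⁅ g (ι i) ⁆) (x∈p∪q⁺ (inj₁ x∈))
    where
    k≤ : k ≤ # (adj u v)
    k≤ = codeg (adj⁺ e∈H)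
    ι : Fin k → Fin (# (adj u v))
    ι i = inject≤ i k≤
    uvg : ∀ i → adj u v (g i) ≡ true
    uvg i = ∈-tabulate⁻ (adj u v) (g∈ i)

  has-edge⁻ : (∃[ e ] Edge H e) → ∃[ u ] ∃[ v ] ∃[ w ] adj u v w ≡ true
  has-edge⁻ (e , e∈H) with ∣S∣≡3⇒S≡triple {S = e} (uniform H e∈H)
  ... | u , v , w , refl = u , v , w , adj⁺ e∈H

-- Blow-ups and their isomorphisms.

K₃³ : Hypergraph 3 3
K₃³ = fromEdges (⊤ ∷ [])

-- The blow-ups of the single edge `K₃³` are the complete 3-partite 3-graphs, so this one identity
-- serves both extremal families.
BlowUp : Hypergraph 3 m → (Fin n → Fin m) → Hypergraph 3 n → Set
BlowUp F c H = ∀ u v w → adj H u v w ≡ adj F (c u) (c v) (c w)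

BalancedBlowUp : Hypergraph 3 m → Hypergraph 3 n → ℕ → Set
BalancedBlowUp {m = m} {n = n} F H s = Σ[ c ∈ (Fin n → Fin m) ] (BlowUp F c H × (∀ i → ∣ class c i ∣ ≡ s))

completeBalanced3Partite⇒blowUp : (H : Hypergraph 3 n)
  (P : IsCompleteBalanced3Partite H) → BlowUp K₃³ (proj₁ P) H
completeBalanced3Partite⇒blowUp {n} H (c , _ , edge⇔) u v w = ⇔→≡ (mk⇔ to from)
  where
  to : adj H u v w ≡ true → adj K₃³ (c u) (c v) (c w) ≡ true
  to uvw = adj⁺ K₃³ (here (⊆-antisym (λ _ → ∈⊤) λ {i} _ → hit i))
    where
    hit : ∀ i → i ∈ triple (c u) (c v) (c w)
    hit i with ∣S∣≡suc⇒Nonempty {S = triple u v w ∩ class c i}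
                 (proj₂ (Equivalence.to (edge⇔ _) (adj⁻ H uvw)) i)
    ... | x , x∈ with x∈p∩q⁻ (triple u v w) (class c i) x∈
    ... | x∈S , x∈i = subst (i ∈_) (image-triple c u v w)
                        (subst (_∈ image c (triple u v w)) (∈-class⁻ c x∈i) (∈-image⁺ c x∈S))
  from : adj K₃³ (c u) (c v) (c w) ≡ true → adj H u v w ≡ true
  from rainbow = adj⁺ H (Equivalence.from (edge⇔ _)
    (∣triple∣ (cu≢cv ∘ cong c) (cu≢cw ∘ cong c) (cv≢cw ∘ cong c) , meets))
    where
    cu≢cv : c u ≢ c v
    cu≢cv = adj⇒u≢v K₃³ {w = c w} rainbow
    cu≢cw : c u ≢ c w
    cu≢cw = adj⇒u≢w K₃³ {v = c v} rainbow
    cv≢cw : c v ≢ c w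
    cv≢cw = adj⇒v≢w K₃³ {u = c u} rainbow
    c-injective : x ∈ triple u v w → y ∈ triple u v w → c x ≡ c y → x ≡ y
    c-injective x∈ y∈ eq with ∈-triple⁻ {u = u} {v} {w} x∈ | ∈-triple⁻ {u = u} {v} {w} y∈
    ... | inj₁ refl | inj₁ refl = refl
    ... | inj₁ refl | inj₂ (inj₁ refl) = contradiction eq cu≢cv
    ... | inj₁ refl | inj₂ (inj₂ refl) = contradiction eq cu≢cw
    ... | inj₂ (inj₁ refl) | inj₁ refl = contradiction (sym eq) cu≢cv
    ... | inj₂ (inj₁ refl) | inj₂ (inj₁ refl) = refl
    ... | inj₂ (inj₁ refl) | inj₂ (inj₂ refl) = contradiction eq cv≢cw
    ... | inj₂ (inj₂ refl) | inj₁ refl = contradiction (sym eq) cu≢cw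
    ... | inj₂ (inj₂ refl) | inj₂ (inj₁ refl) = contradiction (sym eq) cv≢cw
    ... | inj₂ (inj₂ refl) | inj₂ (inj₂ refl) = refl
    meets : ∀ i → ∣ triple u v w ∩ class c i ∣ ≡ 1
    meets i with adj⁻ K₃³ {c u} {c v} {c w} rainbow
    ... | here full with ∈-image⁻ {S = triple u v w} c
            (subst (i ∈_) (trans (sym full) (sym (image-triple c u v w))) ∈⊤)
    ... | x , x∈S , refl = trans (cong ∣_∣ (⊆-antisym ⊆x x⊆)) (∣⁅x⁆∣≡1 x)
      where
      ⊆x : triple u v w ∩ class c (c x) ⊆ ⁅ x ⁆
      ⊆x y∈ with x∈p∩q⁻ (triple u v w) (class c (c x)) y∈
      ... | y∈S , y∈cx = subst (_∈ ⁅ x ⁆) (sym (c-injective y∈S x∈S (∈-class⁻ c y∈cx))) (x∈⁅x⁆ x)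
      x⊆ : ⁅ x ⁆ ⊆ triple u v w ∩ class c (c x)
      x⊆ y∈ = subst (_∈ _) (sym (x∈⁅y⁆⇒x≡y x y∈)) (x∈p∩q⁺ (x∈S , ∈-class⁺ c refl))

blowUpAlong⇒blowUp : (F : Hypergraph 3 m) (c : Fin n → Fin m) (H : Hypergraph 3 n) →
                     IsBlowUpAlong F c H → BlowUp F c H
blowUpAlong⇒blowUp F c H edge⇔ u v w = ⇔→≡ (mk⇔ to from)
  where
  to : adj H u v w ≡ true → adj F (c u) (c v) (c w) ≡ true
  to uvw with Equivalence.to (edge⇔ _) (adj⁻ H uvw)
  ... | u′ , v′ , w′ , eq , edge = adj⁺ F (subst (Edge F)
        (trans (sym (image-triple c u′ v′ w′)) (trans (cong (image c) (sym eq)) (image-triple c u v w))) edge)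
  from : adj F (c u) (c v) (c w) ≡ true → adj H u v w ≡ true
  from cuvw = adj⁺ H (Equivalence.from (edge⇔ _) (u , v , w , refl , adj⁻ F cuvw))

blowUp-K₄⁻-free : {F : Hypergraph 3 m} {c : Fin n → Fin m} {H : Hypergraph 3 n} →
                  K₄⁻-free F → BlowUp F c H → K₄⁻-free H
blowUp-K₄⁻-free {c = c} free blowUp x y z w xyz xyw = trans (blowUp x z w)
  (free (c x) (c y) (c z) (c w) (trans (sym (blowUp x y z)) xyz) (trans (sym (blowUp x y w)) xyw))

cong₃ : ∀ {A B : Set} (f : A → A → A → B) {a a′ b b′ c c′} → a ≡ a′ → b ≡ b′ → c ≡ c′ → f a b c ≡ f a′ b′ c′
cong₃ f refl refl refl = refl

image-inverse : (φ : Permutation m n) (e : Subset m) →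
                image (Inverse.from φ) (image (Inverse.to φ) e) ≡ e
image-inverse φ e = ⊆-antisym to from
  where
  to : image (Inverse.from φ) (image (Inverse.to φ) e) ⊆ e
  to x∈ with ∈-image⁻ {S = image (Inverse.to φ) e} _ x∈
  ... | y , y∈ , refl with ∈-image⁻ {S = e} _ y∈
  ... | z , z∈ , refl = subst (_∈ e) (sym (inverseˡ φ)) z∈
  from : e ⊆ image (Inverse.from φ) (image (Inverse.to φ) e)
  from {x} x∈ = subst (_∈ _) (inverseˡ φ) (∈-image⁺ (Inverse.from φ) (∈-image⁺ (Inverse.to φ) x∈))

≅⇒adj : {G : Hypergraph 3 n} {H : Hypergraph 3 m} (ψ : G ≅ H) → let φ = Inverse.to (proj₁ ψ) in
        ∀ u v w → adj G u v w ≡ adj H (φ u) (φ v) (φ w)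
≅⇒adj {G = G} {H} (φ , edge⇔) u v w = ⇔→≡ (mk⇔
  (λ uvw → adj⁺ H (subst (Edge H) (image-triple _ u v w) (Equivalence.to (edge⇔ _) (adj⁻ G uvw))))
  (λ uvw → adj⁺ G (Equivalence.from (edge⇔ _) (subst (Edge H) (sym (image-triple _ u v w)) (adj⁻ H uvw)))))

adj⇒≅ : {G : Hypergraph 3 n} {H : Hypergraph 3 m} (φ : Permutation n m) →
        (∀ u v w → adj G u v w ≡ adj H (φ ⟨$⟩ʳ u) (φ ⟨$⟩ʳ v) (φ ⟨$⟩ʳ w)) → G ≅ H
adj⇒≅ {G = G} {H} φ adj≡ = φ , λ e → mk⇔ (to e) (from e)
  where
  to : ∀ e → Edge G e → Edge H (image (φ ⟨$⟩ʳ_) e)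
  to e e∈G with ∣S∣≡3⇒S≡triple {S = e} (uniform G e∈G)
  ... | u , v , w , refl = subst (Edge H) (sym (image-triple _ u v w))
        (adj⁻ H (trans (sym (adj≡ u v w)) (adj⁺ G e∈G)))
  from : ∀ e → Edge H (image (φ ⟨$⟩ʳ_) e) → Edge G e
  from e e∈H with ∣S∣≡3⇒S≡triple {S = image (φ ⟨$⟩ʳ_) e} (uniform H e∈H)
  ... | u , v , w , eq = subst (Edge G) triple≡e (adj⁻ G (trans (adj≡ _ _ _)
        (trans (cong₃ (adj H) (inverseʳ φ) (inverseʳ φ) (inverseʳ φ)) (adj⁺ H (subst (Edge H) eq e∈H)))))
    where
    triple≡e : triple (φ ⟨$⟩ˡ u) (φ ⟨$⟩ˡ v) (φ ⟨$⟩ˡ w) ≡ e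
    triple≡e = trans (sym (image-triple _ u v w)) (trans (cong (image (φ ⟨$⟩ˡ_)) (sym eq)) (image-inverse φ e))

#-punchIn : (P : Fin (suc n) → Bool) (w : Fin (suc n)) → # P ≡ ∣ P w ∷ tabulate (P ∘ punchIn w) ∣
#-punchIn P zero = refl
#-punchIn {suc n} P (suc w) with P zero | P (suc w) | #-punchIn (P ∘ suc) w
... | true  | true  | ih = cong suc ih
... | true  | false | ih = cong suc ih
... | false | true  | ih = ih
... | false | false | ih = ih

∣∷∣-cancel : ∀ {s t} (p q : Subset n) → s ≡ t → ∣ s ∷ p ∣ ≡ ∣ t ∷ q ∣ → ∣ p ∣ ≡ ∣ q ∣
∣∷∣-cancel {s = true} p q refl eq = suc-injectiveⁿ eq
∣∷∣-cancel {s = false} p q refl eq = eq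

-- Greedy matching: the first vertex goes to any `w` of its class on the other side, which exists
-- because the sizes agree; deleting both keeps the sizes equal.
match-classes : (c c′ : Fin n → Fin m) → (∀ i → ∣ class c i ∣ ≡ ∣ class c′ i ∣) →
                Σ[ φ ∈ Permutation n n ] (∀ v → c′ (φ ⟨$⟩ʳ v) ≡ c v)
match-classes {n = zero} c c′ sizes = id , λ ()
match-classes {n = suc n} c c′ sizes
  with ∣S∣≡suc⇒Nonempty {S = class c′ (c zero)} {k = ∣ class (c ∘ suc) (c zero) ∣}
         (trans (sym (sizes (c zero)))
           (cong (λ b → ∣ b ∷ class (c ∘ suc) (c zero) ∣) (dec-true (c zero ≟ c zero) refl)))
... | w , w∈ with match-classes (c ∘ suc) (c′ ∘ punchIn w) (λ i → ∣∷∣-cancel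
        (class (c ∘ suc) i) (class (c′ ∘ punchIn w) i)
        (cong (λ j → does (j ≟ i)) (sym (∈-class⁻ c′ w∈)))
        (trans (sizes i) (#-punchIn (λ v → does (c′ v ≟ i)) w)))
... | φ , c′φ≗c = insert zero w φ , λ
  { zero → ∈-class⁻ c′ w∈
  ; (suc v) → trans (cong c′ (insert-punchIn zero w φ v)) (c′φ≗c v) }

blowUp-≅ : {F : Hypergraph 3 m} {c c′ : Fin n → Fin m} {G H : Hypergraph 3 n} →
           BlowUp F c G → BlowUp F c′ H → (∀ i → ∣ class c i ∣ ≡ ∣ class c′ i ∣) → G ≅ H
blowUp-≅ {F = F} {c} {c′} {G} {H} bG bH sizes with match-classes c c′ sizes
... | φ , eq = adj⇒≅ {G = G} {H} φ λ u v w → trans (bG u v w) (trans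
      (sym (cong₃ (adj F) (eq u) (eq v) (eq w)))
      (sym (bH _ _ _)))

blowUp-∘ : {F : Hypergraph 3 m} {c : Fin n → Fin m} {G H : Hypergraph 3 n} →
           BlowUp F c G → (ψ : H ≅ G) → BlowUp F (c ∘ Inverse.to (proj₁ ψ)) H
blowUp-∘ {G = G} {H} b ψ u v w = trans (≅⇒adj {G = H} {G} ψ u v w) (b _ _ _)

sum-indicator : (j : Fin m) → sum (λ i → if does (j ≟ i) then 1 else 0) ≡ 1
sum-indicator {suc m} zero = cong suc (sum-replicate-zero m)
sum-indicator (suc j) = sum-indicator j

∣∷∣ : ∀ s (p : Subset n) → ∣ s ∷ p ∣ ≡ (if s then 1 else 0) + ∣ p ∣
∣∷∣ true p = refl
∣∷∣ false p = refl

sum-classes : (c : Fin n → Fin m) → sum (λ i → ∣ class c i ∣) ≡ n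
sum-classes {zero} {m} c = sum-replicate-zero m
sum-classes {suc n} c = begin
  sum (λ i → ∣ class c i ∣)
    ≡⟨ sum-cong-≗ (λ i → ∣∷∣ (does (c zero ≟ i)) (class (c ∘ suc) i)) ⟩
  sum (λ i → (if does (c zero ≟ i) then 1 else 0) + ∣ class (c ∘ suc) i ∣)
    ≡⟨ ∑-distrib-+ _ (λ i → ∣ class (c ∘ suc) i ∣) ⟩
  sum (λ i → if does (c zero ≟ i) then 1 else 0) + sum (λ i → ∣ class (c ∘ suc) i ∣)
    ≡⟨ cong₂ _+_ (sum-indicator (c zero)) (sum-classes (c ∘ suc)) ⟩
  suc n ∎
  where open ≡-Reasoning

three-parts : ∀ {p q r} → k ≤ p → k ≤ q → k ≤ r → p + (q + r) ≤ k + (k + k) → p ≡ k × q ≡ k × r ≡ k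
three-parts {k} {p} {q} {r} k≤p k≤q k≤r sum≤ =
    ≤-antisym (+-cancelʳ-≤ (k + k) p k (≤-trans (+-monoʳ-≤ p (+-mono-≤ k≤q k≤r)) sum≤)) k≤p
  , ≤-antisym (+-cancelʳ-≤ k q k (+-cancelˡ-≤ k _ _ (≤-trans (+-mono-≤ k≤p (+-monoʳ-≤ q k≤r)) sum≤))) k≤q
  , ≤-antisym (+-cancelˡ-≤ k r k (+-cancelˡ-≤ k _ _ (≤-trans (+-mono-≤ k≤p (+-monoˡ-≤ r k≤q)) sum≤))) k≤r

-- Saturation and finite facts about `K₃³` and `H₆`.

Saturated : Hypergraph 3 m → Set
Saturated F = ∀ i j l → adj F i j l ≡ false →
  i ≡ j ⊎ i ≡ l ⊎ j ≡ l ⊎ ∃[ h ] (adj F i j h ≡ true × adj F i l h ≡ true)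

saturated? : (F : Hypergraph 3 m) → Dec (Saturated F)
saturated? F = all? λ i → all? λ j → all? λ l → adj F i j l ≟ᵇ false →-dec
  (i ≟ j ⊎-dec i ≟ l ⊎-dec j ≟ l ⊎-dec any? λ h → adj F i j h ≟ᵇ true ×-dec adj F i l h ≟ᵇ true)

K₄⁻-free? : (F : Hypergraph 3 m) → Dec (K₄⁻-free F)
K₄⁻-free? F = all? λ a → all? λ b → all? λ c → all? λ d →
  adj F a b c ≟ᵇ true →-dec adj F a b d ≟ᵇ true →-dec adj F a c d ≟ᵇ false

∀Bool? : {P : Bool → Set} → (∀ b → Dec (P b)) → Dec (∀ b → P b)
∀Bool? P? = map′ (λ { (t , f) true → t ; (t , f) false → f }) (λ p → p true , p false) (P? true ×-dec P? false)

-- The value at {x, j, l} that the cocycle condition on {0, x, j, l} dictates when a vertex x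
-- is added to H₆ and bₗ is the value at {0, x, l}.
extension : (b₁ b₂ b₃ b₄ b₅ : Bool) → Fin 6 → Fin 6 → Bool
extension b₁ b₂ b₃ b₄ b₅ j l = b j xor (b l xor adj H₆ 0F j l)
  where
  b : Fin 6 → Bool
  b = lookup (false ∷ b₁ ∷ b₂ ∷ b₃ ∷ b₄ ∷ b₅ ∷ [])

opaque
  unfolding adj

  K₃³-saturated : Saturated K₃³
  K₃³-saturated = from-yes (saturated? K₃³)

  H₆-saturated : Saturated H₆
  H₆-saturated = from-yes (saturated? H₆)

  H₆-K₄⁻-free : K₄⁻-free H₆
  H₆-K₄⁻-free = from-yes (K₄⁻-free? H₆)

  K₃³-K₄⁻-free : K₄⁻-free K₃³
  K₃³-K₄⁻-free = from-yes (K₄⁻-free? K₃³)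

  K₃³-neighbourhoods : ∀ i → ∃[ p ] ∃[ r ] (∀ x → does (x ≟ i) ≡ adj K₃³ p r x)
  K₃³-neighbourhoods = from-yes (all? λ i → any? λ p → any? λ r → all? λ x →
    does (x ≟ i) ≟ᵇ adj K₃³ p r x)

  -- This makes the sum of any two class sizes of a blow-up a codegree, so that equal codegrees
  -- force equal classes.
  H₆-neighbourhoods : ∀ i l → i ≢ l → ∃[ p ] ∃[ r ] (∀ x → does (x ≟ i) ∨ does (x ≟ l) ≡ adj H₆ p r x)
  H₆-neighbourhoods = from-yes (all? λ i → all? λ l → ¬? (i ≟ l) →-dec any? λ p → any? λ r → all? λ x →
    (does (x ≟ i) ∨ does (x ≟ l)) ≟ᵇ adj H₆ p r x)

  H₆-second : ∀ i j l → adj H₆ i j l ≡ true → ∃[ h ] (l ≢ h × adj H₆ i j h ≡ true)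
  H₆-second = from-yes (all? λ i → all? λ j → all? λ l →
    adj H₆ i j l ≟ᵇ true →-dec any? λ h → ¬? (l ≟ h) ×-dec adj H₆ i j h ≟ᵇ true)

  H₆-covers : ∀ i j → i ≢ j → ∃[ l ] adj H₆ i j l ≡ true
  H₆-covers = from-yes (all? λ i → all? λ j → ¬? (i ≟ j) →-dec any? λ l → adj H₆ i j l ≟ᵇ true)

  -- The link of e is a 5-cycle, which contains i unless i = e; j l is an edge of it that
  -- does not meet the neighbours of i.
  H₆-separating : ∀ i e → ∃[ j ] ∃[ l ] (adj H₆ i e j ≡ false × adj H₆ i e l ≡ false × adj H₆ e j l ≡ true)
  H₆-separating = from-yes (all? λ i → all? λ e → any? λ j → any? λ l →
    adj H₆ i e j ≟ᵇ false ×-dec adj H₆ i e l ≟ᵇ false ×-dec adj H₆ e j l ≟ᵇ true)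

  -- The five bits are all the freedom that the cocycle condition leaves to a new vertex. Either it
  -- duplicates a vertex `i`, or it lies with `j`, `l`, `h` in a copy of `K₄⁻` centred at `j`.
  H₆-extensions : ∀ b₁ b₂ b₃ b₄ b₅ → let t = extension b₁ b₂ b₃ b₄ b₅ in
      (∃[ i ] (∀ j l → t j l ≡ adj H₆ i j l))
    ⊎ (∃[ j ] ∃[ l ] ∃[ h ] (t j l ≡ true × t j h ≡ true × adj H₆ j l h ≡ true))
  H₆-extensions = from-yes (∀Bool? λ b₁ → ∀Bool? λ b₂ → ∀Bool? λ b₃ → ∀Bool? λ b₄ → ∀Bool? λ b₅ →
    let t = extension b₁ b₂ b₃ b₄ b₅ in
    (any? λ i → all? λ j → all? λ l → t j l ≟ᵇ adj H₆ i j l) ⊎-dec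
    (any? λ j → any? λ l → any? λ h → t j l ≟ᵇ true ×-dec t j h ≟ᵇ true ×-dec adj H₆ j l h ≟ᵇ true))

-- The codegree bound and the tight case.

-- p, q, r, s are the indicators of the four triples of a quadruple.
parity : ∀ p q r s →
         (p ≡ true → q ≡ true → r ≡ false) → (p ≡ true → q ≡ true → s ≡ false) →
         (p ≡ true → r ≡ true → s ≡ false) → (q ≡ true → r ≡ true → s ≡ false) →
         (p ≡ true → q ∨ (r ∨ s) ≡ true) → (q ≡ true → p ∨ (r ∨ s) ≡ true) →
         (r ≡ true → p ∨ (q ∨ s) ≡ true) → (s ≡ true → p ∨ (q ∨ r) ≡ true) →
         s ≡ p xor (q xor r)
parity true  true  true  s     pqr _ _ _ _ _ _ _ = contradiction (pqr refl refl) λ ()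
parity true  true  false s     _ pqs _ _ _ _ _ _ = pqs refl refl
parity true  false true  s     _ _ prs _ _ _ _ _ = prs refl refl
parity true  false false true  _ _ _ _ _ _ _ _ = refl
parity true  false false false _ _ _ _ p _ _ _ = contradiction (p refl) λ ()
parity false true  true  s     _ _ _ qrs _ _ _ _ = qrs refl refl
parity false true  false true  _ _ _ _ _ _ _ _ = refl
parity false true  false false _ _ _ _ _ q _ _ = contradiction (q refl) λ ()
parity false false true  true  _ _ _ _ _ _ _ _ = refl
parity false false true  false _ _ _ _ _ _ r _ = contradiction (r refl) λ ()
parity false false false true  _ _ _ _ _ _ _ s = contradiction (s refl) λ ()
parity false false false false _ _ _ _ _ _ _ _ = refl

∨-false⇒false : ∀ {p q r} → p ∨ (q ∨ r) ≡ true → p ≡ false → q ≡ false → r ≡ true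
∨-false⇒false eq refl refl = eq

module _ (H : Hypergraph 3 n) (free : K₄⁻-free H) where

  private
    A : Fin n → Fin n → Fin n → Bool
    A = adj H

  cyc : ∀ u v w → A u v w ≡ A v w u
  cyc u v w = trans (adj-swap₁₂ H u v w) (adj-swap₂₃ H v u w)

  module _ (codeg : CodegreesAtLeast H k) {a b c : Fin n} (abc : A a b c ≡ true) where

    private
      N : Fin n → Bool
      N x = A a b x ∨ (A a c x ∨ A b c x)

    ab∩ac : ∀ x → A a b x ≡ true → A a c x ≡ true → ⊥
    ab∩ac x abx acx = false≢true (free a b c x abc abx) acx

    ab∩bc : ∀ x → A a b x ≡ true → A b c x ≡ true → ⊥
    ab∩bc x abx bcx = false≢true
      (free b a c x (trans (adj-swap₁₂ H b a c) abc) (trans (adj-swap₁₂ H b a x) abx)) bcx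

    ac∩bc : ∀ x → A a c x ≡ true → A b c x ≡ true → ⊥
    ac∩bc x acx bcx = false≢true
      (free c a b x (trans (cyc c a b) abc) (trans (adj-swap₁₂ H c a x) acx)) (trans (adj-swap₁₂ H c b x) bcx)

    #N : # N ≡ # (A a b) + (# (A a c) + # (A b c))
    #N = trans
      (#-∨ (A a b) _ λ x abx → disjoint x abx)
      (cong (# (A a b) +_) (#-∨ (A a c) (A b c) ac∩bc))
      where
      disjoint : ∀ x → A a b x ≡ true → A a c x ∨ A b c x ≡ true → ⊥
      disjoint x abx or with A a c x in acx
      ... | true = ab∩ac x abx acx
      ... | false = ab∩bc x abx or

    k≤ab : k ≤ # (A a b)
    k≤ab = codeg abc

    k≤ac : k ≤ # (A a c)
    k≤ac = codeg (trans (adj-swap₂₃ H a c b) abc)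

    k≤bc : k ≤ # (A b c)
    k≤bc = codeg (trans (cyc b c a) (trans (cyc c a b) abc))

    3k≤n : k + (k + k) ≤ n
    3k≤n = ≤-trans (+-mono-≤ k≤ab (+-mono-≤ k≤ac k≤bc)) (≤-trans (≤-reflexive (sym #N)) (∣p∣≤n (tabulate N)))

    module _ (n≡3k : n ≡ k + (k + k)) where

      private
        sum≤ : # (A a b) + (# (A a c) + # (A b c)) ≤ k + (k + k)
        sum≤ = ≤-trans (≤-reflexive (sym #N)) (≤-trans (∣p∣≤n (tabulate N)) (≤-reflexive n≡3k))

        sizes : # (A a b) ≡ k × # (A a c) ≡ k × # (A b c) ≡ k
        sizes = three-parts k≤ab k≤ac k≤bc sum≤

      codegree≡k : # (A a b) ≡ k
      codegree≡k = proj₁ sizes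

      cover : ∀ x → A a b x ∨ (A a c x ∨ A b c x) ≡ true
      cover = #≡n⇒all N (trans #N (trans
        (cong₂ _+_ (proj₁ sizes) (cong₂ _+_ (proj₁ (proj₂ sizes)) (proj₂ (proj₂ sizes)))) (sym n≡3k)))

  module Tight (codeg : CodegreesAtLeast H k) (n≡3k : n ≡ k + (k + k)) where

    covers : ∀ {a b c} → A a b c ≡ true → ∀ x → A a b x ∨ (A a c x ∨ A b c x) ≡ true
    covers abc = cover codeg abc n≡3k

    -- Three or four edges on a quadruple contain a copy of `K₄⁻`. A lone edge would leave the
    -- fourth vertex outside all three of its common neighbourhoods, against `covers`.
    cocycle : ∀ a b c d → A b c d ≡ A a b c xor (A a b d xor A a c d)
    cocycle a b c d = parity (A a b c) (A a b d) (A a c d) (A b c d)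
      (free a b c d)
      (λ p q → free b a c d (trans (adj-swap₁₂ H b a c) p) (trans (adj-swap₁₂ H b a d) q))
      (λ p r → trans (adj-swap₁₂ H b c d) (free c a b d (trans (cyc c a b) p) (trans (adj-swap₁₂ H c a d) r)))
      (λ q r → trans (trans (cyc b c d) (trans (cyc c d b) refl))
                     (free d a b c (trans (cyc d a b) q) (trans (cyc d a c) r)))
      (λ p → covers p d)
      (λ q → trans (cong (A a b c ∨_) (cong₂ _∨_ (adj-swap₂₃ H a c d) (adj-swap₂₃ H b c d))) (covers q c))
      (λ r → trans (cong₂ _∨_ (adj-swap₂₃ H a b c) (cong₂ _∨_ (adj-swap₂₃ H a b d) (cyc b c d))) (covers r b))
      (λ s → trans (cong₂ _∨_ (cyc a b c) (cong₂ _∨_ (cyc a b d) (cyc a c d))) (covers s a))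

    Twins : Fin n → Fin n → Set
    Twins x y = ∀ e → A x y e ≡ false

    -- In the cocycle condition on `x y u v` the terms `x y u` and `x y v` vanish.
    twins⇒≗ : ∀ {x y} → Twins x y → ∀ u v → A x u v ≡ A y u v
    twins⇒≗ {x} {y} tw u v = sym (trans (cocycle x y u v)
      (cong₂ (λ p q → p xor (q xor A x u v)) (tw u) (tw v)))

    module _ {F : Hypergraph 3 m} (saturated : Saturated F) (q : Fin m → Fin n)
             (q-edges : ∀ e → Edge F e → Edge H (image q e)) where

      private
        q-edge : ∀ {i j l} → adj F i j l ≡ true → A (q i) (q j) (q l) ≡ true
        q-edge {i} {j} {l} ijl = adj⁺ H (subst (Edge H) (image-triple q i j l) (q-edges _ (adj⁻ F ijl)))

      -- A copy need not be induced in general. Here saturation means that any further triple on the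
      -- copy would complete a `K₄⁻` with two edges already present.
      q-induced : ∀ i j l → A (q i) (q j) (q l) ≡ adj F i j l
      q-induced i j l with adj F i j l in eq
      ... | true = q-edge eq
      ... | false with saturated i j l eq
      ...   | inj₁ refl = adj-uuw H (q i) (q l)
      ...   | inj₂ (inj₁ refl) = trans (adj-swap₂₃ H (q i) (q j) (q i)) (adj-uuw H (q i) (q j))
      ...   | inj₂ (inj₂ (inj₁ refl)) = trans (cyc (q i) (q j) (q j)) (adj-uuw H (q j) (q i))
      ...   | inj₂ (inj₂ (inj₂ (h , ijh , ilh))) = trans (adj-swap₂₃ H (q i) (q j) (q l))
              (trans (adj-swap₂₃ H (q i) (q l) (q j)) (via-h (q-edge {i} {j} {h} ijh) (q-edge {i} {l} {h} ilh)))
        where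
        via-h : A (q i) (q j) (q h) ≡ true → A (q i) (q l) (q h) ≡ true → A (q i) (q j) (q l) ≡ false
        via-h p r = free (q i) (q h) (q j) (q l)
          (trans (adj-swap₂₃ H (q i) (q h) (q j)) p) (trans (adj-swap₂₃ H (q i) (q h) (q l)) r)

      module _ (twin : ∀ x → ∃[ i ] Twins x (q i)) where

        type : Fin n → Fin m
        type x = proj₁ (twin x)

        type-replace : ∀ x u v → A x u v ≡ A (q (type x)) u v
        type-replace x = twins⇒≗ (proj₂ (twin x))

        -- Twins are exchanged in the first position only, so cyclic rotation brings each vertex to
        -- the front once.
        types-blowUp : BlowUp F type H
        types-blowUp x y z = begin
          A x y z    ≡⟨ type-replace x y z ⟩
          A x′ y z   ≡⟨ cyc x′ y z ⟩
          A y z x′   ≡⟨ type-replace y z x′ ⟩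
          A y′ z x′  ≡⟨ cyc y′ z x′ ⟩
          A z x′ y′  ≡⟨ type-replace z x′ y′ ⟩
          A z′ x′ y′ ≡⟨ cyc z′ x′ y′ ⟩
          A x′ y′ z′ ≡⟨ q-induced (type x) (type y) (type z) ⟩
          adj F (type x) (type y) (type z) ∎
          where
          open ≡-Reasoning
          x′ y′ z′ : Fin n
          x′ = q (type x)
          y′ = q (type y)
          z′ = q (type z)

        #-type : ∀ {i j l} → adj F i j l ≡ true → # (λ x → adj F i j (type x)) ≡ k
        #-type {i} {j} {l} ijl = trans (#-cong eq) (codegree≡k codeg (q-edge ijl) n≡3k)
          where
          eq : ∀ x → adj F i j (type x) ≡ A (q i) (q j) x
          eq x = begin
            adj F i j (type x)         ≡⟨ sym (q-induced i j (type x)) ⟩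
            A (q i) (q j) (q (type x)) ≡⟨ sym (cyc (q (type x)) (q i) (q j)) ⟩
            A (q (type x)) (q i) (q j) ≡⟨ sym (type-replace x (q i) (q j)) ⟩
            A x (q i) (q j)            ≡⟨ cyc x (q i) (q j) ⟩
            A (q i) (q j) x            ∎
            where open ≡-Reasoning

    -- Twins of the vertices of a copy of `H₆`.

    module _ (q : Fin 6 → Fin n) (q-edges : ∀ e → Edge H₆ e → Edge H (image q e)) where

      private
        induced : ∀ i j l → A (q i) (q j) (q l) ≡ adj H₆ i j l
        induced = q-induced {F = H₆} H₆-saturated q q-edges

        b : Fin n → Fin 6 → Bool
        b x l = A (q 0F) x (q l)

        t : Fin n → Fin 6 → Fin 6 → Bool
        t x = extension (b x 1F) (b x 2F) (b x 3F) (b x 4F) (b x 5F)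

        A≡t : ∀ x j l → A x (q j) (q l) ≡ t x j l
        A≡t x j l = trans (cocycle (q 0F) x (q j) (q l))
          (cong₂ _xor_ (row j) (cong₂ _xor_ (row l) (induced 0F j l)))
          where
          row : ∀ l → b x l ≡ lookup (false ∷ b x 1F ∷ b x 2F ∷ b x 3F ∷ b x 4F ∷ b x 5F ∷ []) l
          -- Here `q 0F` is repeated in the triple, which explains the `false` at the head of the
          -- vector.
          row 0F = trans (cyc (q 0F) x (q 0F)) (trans (cyc x (q 0F) (q 0F)) (adj-uuw H (q 0F) x))
          row 1F = refl
          row 2F = refl
          row 3F = refl
          row 4F = refl
          row 5F = refl

        -- The finite check sees only pairs inside the copy, so `x` is first compared with `q i` on
        -- these.
        H₆-twin-on-q : ∀ x → ∃[ i ] (∀ j l → A x (q j) (q l) ≡ adj H₆ i j l)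
        H₆-twin-on-q x with H₆-extensions (b x 1F) (b x 2F) (b x 3F) (b x 4F) (b x 5F)
        ... | inj₁ (i , eq) = i , λ j l → trans (A≡t x j l) (eq j l)
        ... | inj₂ (j , l , h , xjl , xjh , jlh) = false≢true
              (free (q j) x (q l) (q h)
                (trans (adj-swap₁₂ H (q j) x (q l)) (trans (A≡t x j l) xjl))
                (trans (adj-swap₁₂ H (q j) x (q h)) (trans (A≡t x j h) xjh)))
              (trans (induced j l h) jlh)

      -- If x q(i) e were an edge, the cocycle condition would turn the edge e q(j) q(l)
      -- supplied by H₆-separating into a copy of K₄⁻ on x, e, q(j), q(l).
      H₆-twin : ∀ x → ∃[ i ] Twins x (q i)
      H₆-twin x with H₆-twin-on-q x
      ... | i , x~i = i , λ e → ¬-not (not-edge e)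
        where
        not-edge : ∀ e → A x (q i) e ≢ true
        not-edge e xie with H₆-twin-on-q e
        ... | h , e~h with H₆-separating i h
        ... | j , l , ihj , ihl , hjl = false≢true (free e x (q j) (q l) (step j ihj) (step l ihl))
              (trans (e~h j l) hjl)
          where
          step : ∀ j → adj H₆ i h j ≡ false → A e x (q j) ≡ true
          step j ihj = begin
            A e x (q j)
              ≡⟨ trans (adj-swap₁₂ H e x (q j)) (cocycle (q i) x e (q j)) ⟩
            A (q i) x e xor (A (q i) x (q j) xor A (q i) e (q j))
              ≡⟨ cong₂ _xor_ (trans (adj-swap₁₂ H (q i) x e) xie) (cong₂ _xor_ xij eij) ⟩
            true ∎
            where
            open ≡-Reasoning
            -- Towards the copy `x` behaves like `q i`, so this triple behaves like one in which
            -- `q i` is repeated.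
            xij : A (q i) x (q j) ≡ false
            xij = trans (adj-swap₁₂ H (q i) x (q j)) (trans (x~i i j) (adj-uuw H₆ i j))
            eij : A (q i) e (q j) ≡ false
            eij = trans (adj-swap₁₂ H (q i) e (q j)) (trans (e~h i j) (trans (adj-swap₁₂ H₆ h i j) ihj))

    H₆-copy⇒blowUp : (q : Fin 6 → Fin n) → (∀ e → Edge H₆ e → Edge H (image q e)) →
                     Σ[ s ∈ ℕ ] BalancedBlowUp H₆ H s
    H₆-copy⇒blowUp q q-edges = ∣ class c 0F ∣
      , c , types-blowUp {F = H₆} H₆-saturated q q-edges (H₆-twin q q-edges) , equal
      where
      c : Fin n → Fin 6
      c = type {F = H₆} H₆-saturated q q-edges (H₆-twin q q-edges)
      sizes : ∀ i l → i ≢ l → ∣ class c i ∣ + ∣ class c l ∣ ≡ k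
      sizes i l i≢l with H₆-neighbourhoods i l i≢l
      ... | p , r , eq = begin
        ∣ class c i ∣ + ∣ class c l ∣
          ≡⟨ sym (#-∨ (λ v → does (c v ≟ i)) (λ v → does (c v ≟ l)) λ v ci cl →
               i≢l (trans (sym (does⁻ (c v ≟ i) ci)) (does⁻ (c v ≟ l) cl))) ⟩
        # (λ v → does (c v ≟ i) ∨ does (c v ≟ l)) ≡⟨ #-cong (λ v → eq (c v)) ⟩
        # (λ v → adj H₆ p r (c v))
          ≡⟨ #-type {F = H₆} H₆-saturated q q-edges (H₆-twin q q-edges) {p} {r} {i}
               (trans (sym (eq i)) (cong (_∨ does (i ≟ l)) (dec-true (i ≟ i) refl))) ⟩
        k ∎
        where open ≡-Reasoning

      third : ∀ (i j : Fin 6) → ∃[ l ] (i ≢ l × j ≢ l)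
      third = from-yes (all? {6} λ i → all? {6} λ j → any? {6} λ l → ¬? (i ≟ l) ×-dec ¬? (j ≟ l))
      -- Two classes are compared through a third one `l`, since both sums with the size of `l`
      -- equal `k`.
      equal : ∀ i → ∣ class c i ∣ ≡ ∣ class c 0F ∣
      equal i with third i 0F
      ... | l , i≢l , 0≢l = +-cancelʳ-≡ _ _ _ (trans (sizes i l i≢l) (sym (sizes 0F l 0≢l)))

    -- From 5-cycles to `H₆`, and the dichotomy.

    -- p₀ … p₄ is H₆ minus a vertex: the consecutive triples of a 5-cycle.
    pentagon⇒H₆-blowUp : 1 ≤ k → ∀ p₀ p₁ p₂ p₃ p₄ →
      A p₀ p₁ p₂ ≡ true → A p₁ p₂ p₃ ≡ true → A p₂ p₃ p₄ ≡ true → A p₃ p₄ p₀ ≡ true → A p₄ p₀ p₁ ≡ true →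
      Σ[ s ∈ ℕ ] BalancedBlowUp H₆ H s
    pentagon⇒H₆-blowUp 1≤k p₀ p₁ p₂ p₃ p₄ p₀₁₂ p₁₂₃ p₂₃₄ p₃₄₀ p₄₀₁
      with any? (λ x → A p₀ p₃ x ≟ᵇ true ×-dec A p₁ p₃ x ≟ᵇ true)
    ... | yes (f , f₀₃ , f₁₃) = H₆-copy⇒blowUp q λ e e∈ → lookupᴬ {P = λ e → Edge H (image q e)}
            ( edge 0F 1F 2F (trans (cyc p₀ p₁ p₄) (trans (cyc p₁ p₄ p₀) p₄₀₁))
            ∷ edge 0F 1F 3F p₀₁₂
            ∷ edge 2F 3F 4F (trans (cyc p₄ p₂ p₃) p₂₃₄)
            ∷ edge 2F 3F 5F (trans (adj-swap₁₂ H p₄ p₂ f) f₂₄)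
            ∷ edge 4F 5F 0F (trans (cyc p₃ f p₀) (trans (cyc f p₀ p₃) f₀₃))
            ∷ edge 4F 5F 1F (trans (cyc p₃ f p₁) (trans (cyc f p₁ p₃) f₁₃))
            ∷ edge 0F 2F 4F (trans (cyc p₀ p₄ p₃) (trans (adj-swap₁₂ H p₄ p₃ p₀) p₃₄₀))
            ∷ edge 0F 3F 5F f₀₂
            ∷ edge 1F 2F 5F f₁₄
            ∷ edge 1F 3F 4F p₁₂₃
            ∷ []) e∈
      where
      q : Fin 6 → Fin n
      -- In this order the triples of `H₆` avoiding `5F` become the consecutive triples of the
      -- 5-cycle, and those through `5F` join `f` to its five diagonals.
      q = lookup (p₀ ∷ p₁ ∷ p₄ ∷ p₂ ∷ p₃ ∷ f ∷ [])
      edge : ∀ i j l → A (q i) (q j) (q l) ≡ true → Edge H (image q (triple i j l))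
      edge i j l ijl = subst (Edge H) (sym (image-triple q i j l)) (adj⁻ H ijl)
      p₀₃₄ : A p₀ p₃ p₄ ≡ true
      p₀₃₄ = trans (cyc p₀ p₃ p₄) p₃₄₀
      p₁₃₂ : A p₁ p₃ p₂ ≡ true
      p₁₃₂ = trans (adj-swap₂₃ H p₁ p₃ p₂) p₁₂₃
      -- The edges `p₀ p₃ f` and `p₁ p₃ f` with freeness keep `f` out of the neighbourhoods of all
      -- five consecutive pairs.
      f₀₁ : A p₀ p₁ f ≡ false
      f₀₁ = trans (trans (cyc p₀ p₁ f) (cyc p₁ f p₀)) (free f p₃ p₀ p₁
        (trans (adj-swap₂₃ H f p₃ p₀) (trans (cyc f p₀ p₃) f₀₃))
        (trans (adj-swap₂₃ H f p₃ p₁) (trans (cyc f p₁ p₃) f₁₃)))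
      f₀₄ : A p₀ p₄ f ≡ false
      f₀₄ = free p₀ p₃ p₄ f p₀₃₄ f₀₃
      f₃₄ : A p₃ p₄ f ≡ false
      f₃₄ = free p₃ p₀ p₄ f (trans (adj-swap₁₂ H p₃ p₀ p₄) p₀₃₄) (trans (adj-swap₁₂ H p₃ p₀ f) f₀₃)
      f₁₂ : A p₁ p₂ f ≡ false
      f₁₂ = free p₁ p₃ p₂ f p₁₃₂ f₁₃
      f₂₃ : A p₂ p₃ f ≡ false
      f₂₃ = trans (adj-swap₁₂ H p₂ p₃ f)
        (free p₃ p₁ p₂ f (trans (adj-swap₁₂ H p₃ p₁ p₂) p₁₃₂) (trans (adj-swap₁₂ H p₃ p₁ f) f₁₃))
      -- Two of the three pairs of the edge `p₀ p₁ p₂` are consecutive and excluded, so covering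
      -- gives `f` to the diagonal. The other two diagonals follow in the same way.
      f₀₂ : A p₀ p₂ f ≡ true
      f₀₂ with A p₀ p₂ f | covers p₀₁₂ f
      ... | true | _ = refl
      ... | false | or = false≢true (cong₂ _∨_ f₀₁ (cong (false ∨_) f₁₂)) or
      f₁₄ : A p₁ p₄ f ≡ true
      f₁₄ = ∨-false⇒false (covers (trans (trans (cyc p₀ p₁ p₄) (cyc p₁ p₄ p₀)) p₄₀₁) f) f₀₁ f₀₄
      f₂₄ : A p₂ p₄ f ≡ true
      f₂₄ with A p₂ p₄ f | covers p₂₃₄ f
      ... | true | _ = refl
      ... | false | or = false≢true (cong₂ _∨_ f₂₃ (cong (false ∨_) f₃₄)) or
    ... | no ∄f = contradiction (subst (1 ≤_) k≡0 1≤k) λ ()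
      where
      -- This non-edge removes one term from the cocycle condition on `p₃ p₀ p₁ x`; what remains is
      -- the symmetric difference.
      p₀₁₃ : A p₀ p₁ p₃ ≡ false
      p₀₁₃ = trans (adj-swap₁₂ H p₀ p₁ p₃) (free p₁ p₂ p₀ p₃
        (trans (adj-swap₂₃ H p₁ p₂ p₀) (trans (adj-swap₁₂ H p₁ p₀ p₂) p₀₁₂)) p₁₂₃)
      disjoint : ∀ x → A p₀ p₃ x ≡ true → A p₁ p₃ x ≡ true → ⊥
      disjoint x x₀₃ x₁₃ = ∄f (x , x₀₃ , x₁₃)
      split-01 : ∀ x → A p₀ p₁ x ≡ A p₀ p₃ x ∨ A p₁ p₃ x
      split-01 x = trans (cocycle p₃ p₀ p₁ x) (trans
        (cong₂ _xor_ (trans (cyc p₃ p₀ p₁) p₀₁₃) (cong₂ _xor_ (adj-swap₁₂ H p₃ p₀ x) (adj-swap₁₂ H p₃ p₁ x)))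
        (xor≡∨ (disjoint x)))
        where
        xor≡∨ : ∀ {p q} → (p ≡ true → q ≡ true → ⊥) → p xor q ≡ p ∨ q
        xor≡∨ {true} {true} pq = ⊥-elim (pq refl refl)
        xor≡∨ {true} {false} pq = refl
        xor≡∨ {false} pq = refl
      k≡0 : k ≡ 0
      k≡0 = +-cancelˡ-≡ k k 0 (begin
        k + k
          ≡⟨ cong₂ _+_ (sym (codegree≡k codeg (trans (cyc p₀ p₃ p₄) p₃₄₀) n≡3k))
                       (sym (codegree≡k codeg (trans (adj-swap₂₃ H p₁ p₃ p₂) p₁₂₃) n≡3k)) ⟩
        # (A p₀ p₃) + # (A p₁ p₃) ≡⟨ sym (#-∨ (A p₀ p₃) (A p₁ p₃) disjoint) ⟩
        # (λ x → A p₀ p₃ x ∨ A p₁ p₃ x) ≡⟨ #-cong (λ x → sym (split-01 x)) ⟩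
        # (A p₀ p₁) ≡⟨ codegree≡k codeg p₀₁₂ n≡3k ⟩
        k ≡⟨ sym (+-identityʳ k) ⟩
        k + 0 ∎)
        where open ≡-Reasoning

    -- Freeness excludes `a c d` and `b c d`, so by the cocycle condition the edge `c d e` forces
    -- exactly one of `a c e`, `a d e` and exactly one of `b c e`, `b d e`. If both choices used
    -- `d`, they would form a `K₄⁻` with `a b d`, and likewise for `c`; so the choices cross.
    pentagon : ∀ {a b c d e} → A a b c ≡ true → A a b d ≡ true → A c d e ≡ true →
               (A a d e ≡ true × A b c e ≡ true) ⊎ (A b d e ≡ true × A a c e ≡ true)
    pentagon {a} {b} {c} {d} {e} abc abd cde
      with A a d e in ade | A b c e in bce | A b d e in bde | A a c e in ace
    ... | true  | true  | _     | _     = inj₁ (refl , refl)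
    ... | _     | _     | true  | true  = inj₂ (refl , refl)
    ... | true  | false | true  | false = false≢true (free d a b e
            (trans (cyc d a b) abd) (trans (adj-swap₁₂ H d a e) ade)) (trans (adj-swap₁₂ H d b e) bde)
    ... | false | true  | false | true  = false≢true (free c a b e
            (trans (cyc c a b) abc) (trans (adj-swap₁₂ H c a e) ace)) (trans (adj-swap₁₂ H c b e) bce)
    ... | false | _     | _     | false = false≢true
            (trans (cocycle a c d e) (cong₂ _xor_ (free a b c d abc abd) (cong₂ _xor_ ace ade))) cde
    ... | _     | false | false | _     = false≢true
            (trans (cocycle b c d e) (cong₂ _xor_
              (free b a c d (trans (adj-swap₁₂ H b a c) abc) (trans (adj-swap₁₂ H b a d) abd))
              (cong₂ _xor_ bce bde))) cde

    -- Without the excluded configuration, common neighbours of a pair are twins. Each vertex is a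
    -- common neighbour of a pair from `a b c`, hence a twin of the remaining vertex.
    tripartite : ∀ {a b c} → A a b c ≡ true →
                 (∀ {a b c d e} → A a b c ≡ true → A a b d ≡ true → A c d e ≢ true) → BalancedBlowUp K₃³ H k
    tripartite {a} {b} {c} abc no-pentagon = τ , types-blowUp {F = K₃³} K₃³-saturated q q-edges twin , sizes
      where
      q : Fin 3 → Fin n
      q = lookup (a ∷ b ∷ c ∷ [])
      q-edges : ∀ e → Edge K₃³ e → Edge H (image q e)
      q-edges _ (here refl) = subst (Edge H) (sym (image-triple q 0F 1F 2F)) (adj⁻ H abc)
      twin : ∀ x → ∃[ i ] Twins x (q i)
      twin x with A a b x in abx | A a c x in acx | covers abc x
      ... | true  | _     | _ = 2F , λ e → ¬-not (no-pentagon abx abc)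
      ... | false | true  | _ = 1F , λ e → ¬-not (no-pentagon acx (trans (adj-swap₂₃ H a c b) abc))
      ... | false | false | bcx = 0F , λ e → ¬-not (no-pentagon bcx (trans (cyc b c a) (trans (cyc c a b) abc)))
      τ : Fin n → Fin 3
      τ = type {F = K₃³} K₃³-saturated q q-edges twin
      sizes : ∀ i → ∣ class τ i ∣ ≡ k
      sizes i with K₃³-neighbourhoods i
      ... | p , r , eq = trans (#-cong (λ v → eq (τ v)))
        (#-type {F = K₃³} K₃³-saturated q q-edges twin {p} {r} {i} (trans (sym (eq i)) (dec-true (i ≟ i) refl)))

    classification : 1 ≤ k → ∀ {a b c} → A a b c ≡ true →
                     BalancedBlowUp K₃³ H k ⊎ Σ[ s ∈ ℕ ] BalancedBlowUp H₆ H s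
    classification 1≤k abc
      with any? (λ a → any? λ b → any? λ c → any? λ d → any? λ e →
                 A a b c ≟ᵇ true ×-dec A a b d ≟ᵇ true ×-dec A c d e ≟ᵇ true)
    ... | no ∄ = inj₁ (tripartite abc λ abc abd cde → ∄ (_ , _ , _ , _ , _ , abc , abd , cde))
    ... | yes (a , b , c , d , e , abc , abd , cde) with pentagon abc abd cde
    -- The 5-cycle is `a b c e d`; in the other case `a` and `b` change places.
    ...   | inj₁ (ade , bce) = inj₂ (pentagon⇒H₆-blowUp 1≤k a b c e d abc bce
            (trans (adj-swap₂₃ H c e d) cde) (trans (trans (cyc e d a) (adj-swap₁₂ H d a e)) ade)
            (trans (cyc d a b) abd))
    ...   | inj₂ (bde , ace) = inj₂ (pentagon⇒H₆-blowUp 1≤k b a c e d (trans (adj-swap₁₂ H b a c) abc) ace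
            (trans (adj-swap₂₃ H c e d) cde) (trans (trans (cyc e d b) (adj-swap₁₂ H d b e)) bde)
            (trans (cyc d b a) (trans (adj-swap₁₂ H b a d) abd)))

#-mono : (P Q : Fin n → Bool) → (∀ x → P x ≡ true → Q x ≡ true) → # P ≤ # Q
#-mono P Q P⇒Q = p⊆q⇒∣p∣≤∣q∣ λ {x} x∈ → ∈-tabulate⁺ Q (P⇒Q x (∈-tabulate⁻ P x∈))

-- Balanced blow-ups: sizes, codegrees and non-isomorphism.

balanced⇒n≡ : {F : Hypergraph 3 m} {H : Hypergraph 3 n} → BalancedBlowUp F H k → n ≡ sum {m} (λ _ → k)
balanced⇒n≡ (c , _ , sizes) = trans (sym (sum-classes c)) (sum-cong-≗ sizes)

balanced-≅ : {F : Hypergraph 3 m} {G H : Hypergraph 3 n} → BalancedBlowUp F G k → BalancedBlowUp F H k → G ≅ H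
balanced-≅ {F = F} {G} {H} (c , bG , sizesG) (c′ , bH , sizesH) =
  blowUp-≅ {F = F} {c} {c′} {G} {H} bG bH λ i → trans (sizesG i) (sym (sizesH i))

-- The partition is pulled back along the isomorphism; injectivity of both directions gives the two
-- inequalities between class sizes.
balanced-≅⁻ : {F : Hypergraph 3 m} {G H : Hypergraph 3 n} → H ≅ G → BalancedBlowUp F G k → BalancedBlowUp F H k
balanced-≅⁻ {F = F} {G} {H} ψ@(φ , _) (c , b , sizes) =
    c ∘ (φ ⟨$⟩ʳ_) , blowUp-∘ {F = F} {c} {G} {H} b ψ
  , λ i → trans (≤-antisym (#-∘ _ (φ ⟨$⟩ʳ_)
      λ eq → trans (sym (inverseˡ φ)) (trans (cong (φ ⟨$⟩ˡ_) eq) (inverseˡ φ))) (back i)) (sizes i)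
  where
  back : ∀ i → ∣ class c i ∣ ≤ ∣ class (c ∘ (φ ⟨$⟩ʳ_)) i ∣
  back i = ≤-trans (≤-reflexive (#-cong λ v → cong (λ w → does (c w ≟ i)) (sym (inverseʳ φ {v}))))
    (#-∘ (λ v → does (c (φ ⟨$⟩ʳ v) ≟ i)) (φ ⟨$⟩ˡ_)
      λ eq → trans (sym (inverseʳ φ)) (trans (cong (φ ⟨$⟩ʳ_) eq) (inverseʳ φ)))

K₃³-codegrees : {c : Fin n → Fin 3} {H : Hypergraph 3 n} → BlowUp K₃³ c H →
                (∀ i → k ≤ ∣ class c i ∣) → CodegreesAtLeast H k
K₃³-codegrees {c = c} {H} b k≤ {u} {v} {w} uvw = ≤-trans (k≤ (c w)) (#-mono _ (adj H u v) λ x cx → trans (b u v x)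
  (trans (cong (adj K₃³ (c u) (c v)) (does⁻ (c x ≟ c w) cx)) (trans (sym (b u v w)) uvw)))

-- Besides the class of `w`, a second whole class completes `u v`, because a pair inside an edge of
-- `H₆` lies in another edge too.
H₆-codegrees : {H : Hypergraph 3 n} → BalancedBlowUp H₆ H k → CodegreesAtLeast H (k + k)
H₆-codegrees {k = k} {H} (c , b , sizes) {u} {v} {w} uvw
  with H₆-second (c u) (c v) (c w) (trans (sym (b u v w)) uvw)
... | l , w≢l , uvl = ≤-trans (≤-reflexive size) (#-mono P (adj H u v) λ x Px → trans (b u v x) (P⊆N x Px))
  where
  P : Fin _ → Bool
  P x = does (c x ≟ c w) ∨ does (c x ≟ l)
  size : k + k ≡ # P
  size = sym (trans (#-∨ (λ x → does (c x ≟ c w)) (λ x → does (c x ≟ l))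
    λ x cw cl → w≢l (trans (sym (does⁻ (c x ≟ c w) cw)) (does⁻ (c x ≟ l) cl))) (cong₂ _+_ (sizes (c w)) (sizes l)))
  P⊆N : ∀ x → P x ≡ true → adj H₆ (c u) (c v) (c x) ≡ true
  P⊆N x Px with c x ≟ c w
  ... | yes eq = trans (cong (adj H₆ (c u) (c v)) eq) (trans (sym (b u v w)) uvw)
  ... | no _ = trans (cong (adj H₆ (c u) (c v)) (does⁻ (c x ≟ l) Px)) uvl

representatives : {F : Hypergraph 3 m} {H : Hypergraph 3 n} → 1 ≤ k → ((c , _) : BalancedBlowUp F H k) →
                  Σ[ r ∈ (Fin m → Fin n) ] (∀ i → c (r i) ≡ i)
representatives (s≤s _) (c , _ , sizes) = proj₁ ∘ rep , λ i → ∈-class⁻ c (proj₂ (rep i))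
  where
  rep : ∀ i → Nonempty (class c i)
  rep i = ∣S∣≡suc⇒Nonempty {S = class c i} (sizes i)

balanced-edge : {F : Hypergraph 3 m} {H : Hypergraph 3 n} → 1 ≤ k → BalancedBlowUp F H k →
                ∀ {i j l} → adj F i j l ≡ true → ∃[ e ] Edge H e
balanced-edge {F = F} {H} 1≤k b@(c , blowUp , _) {i} {j} {l} ijl with representatives {F = F} {H} 1≤k b
... | r , c∘r = triple (r i) (r j) (r l) , adj⁻ H
      (trans (blowUp (r i) (r j) (r l)) (trans (cong₃ (adj F) (c∘r i) (c∘r j) (c∘r l)) ijl))

-- Among six representatives of the classes of `B`, two fall into the same class of `T` and so share
-- no edge there, whereas any two vertices of `H₆` lie in an edge.
K₃³≇H₆ : {T B : Hypergraph 3 n} → 1 ≤ k → (c : Fin n → Fin 3) → BlowUp K₃³ c T →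
         BalancedBlowUp H₆ B k → ¬ (T ≅ B)
K₃³≇H₆ {T = T} {B} 1≤k c bT b@(c′ , bB , _) ψ@(φ , _) with representatives {F = H₆} {B} 1≤k b
... | r , c′∘r with pigeonhole (s≤s (s≤s (s≤s (s≤s z≤n)))) (λ i → c (φ ⟨$⟩ˡ r i))
... | i , j , i<j , eq with H₆-covers i j (<⇒≢ i<j)
... | l , ijl = false≢true (trans (bT (z i) (z j) (z l))
        (trans (cong (λ a → adj K₃³ a (c (z j)) (c (z l))) eq) (adj-uuw K₃³ (c (z j)) (c (z l)))))
      (trans (≅⇒adj {G = T} {B} ψ (z i) (z j) (z l))
        (trans (cong₃ (adj B) (inverseʳ φ) (inverseʳ φ) (inverseʳ φ))
          (trans (bB (r i) (r j) (r l)) (trans (cong₃ (adj H₆) (c′∘r i) (c′∘r j) (c′∘r l)) ijl))))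
  where
  z : Fin 6 → Fin _
  z h = φ ⟨$⟩ˡ r h

-- Arithmetic of `n / 3` and the constructions.

m+[m+m]≡m*3 : ∀ m → m + (m + m) ≡ m * 3
m+[m+m]≡m*3 = solve 1 (λ m → m :+ (m :+ m) := m :* con 3) refl

3k≤n⇒k≤n/3 : k + (k + k) ≤ n → k ≤ n / 3
3k≤n⇒k≤n/3 {k} {n} 3k≤n = ≤-trans (≤-reflexive (sym (m*n/n≡m k 3)))
  (/-monoˡ-≤ 3 (≤-trans (≤-reflexive (sym (m+[m+m]≡m*3 k))) 3k≤n))

δ⁺≤n/3 : (H : Hypergraph 3 n) → K₄⁻-free H → (∃[ e ] Edge H e) → PositiveCodegree≥ H k → k ≤ n / 3
δ⁺≤n/3 H free e δ with has-edge⁻ H e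
... | u , v , w , uvw = 3k≤n⇒k≤n/3 (3k≤n H free (codegrees⁺ H δ) uvw)

δ⁺≡n/3 : (H : Hypergraph 3 n) → K₄⁻-free H → (∃[ e ] Edge H e) → CodegreesAtLeast H (n / 3) → Isδ⁺ H (n / 3)
δ⁺≡n/3 H free e codeg = inj₁ (e , codegrees⁻ H codeg , λ j → δ⁺≤n/3 H free e)

-- The other two classes exceed class `i` by at most one each, so `n` is at most three times its
-- size plus 2, which is still below three times the successor of its size.
balanced-classes : (c : Fin n → Fin 3) → (∀ i j → ∣ class c i ∣ ≤ suc ∣ class c j ∣) →
                   ∀ i → n / 3 ≤ ∣ class c i ∣
balanced-classes {n} c bal i = ≤-pred (m<n*o⇒m/o<n (subst (_< suc (s i) * 3) (sum-classes c) (bound i)))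
  where
  s : Fin 3 → ℕ
  s i = ∣ class c i ∣
  bound : ∀ i → s 0F + (s 1F + (s 2F + 0)) < suc (s i) * 3
  bound 0F = s≤s (≤-trans (+-mono-≤ (≤-refl {s 0F}) (+-mono-≤ (bal 1F 0F) (+-mono-≤ (bal 2F 0F) z≤n)))
    (≤-reflexive (solve 1 (λ s → s :+ (con 1 :+ s :+ (con 1 :+ s :+ con 0)) := con 2 :+ s :* con 3) refl (s 0F))))
  bound 1F = s≤s (≤-trans (+-mono-≤ (bal 0F 1F) (+-mono-≤ (≤-refl {s 1F}) (+-mono-≤ (bal 2F 1F) z≤n)))
    (≤-reflexive (solve 1 (λ s → con 1 :+ s :+ (s :+ (con 1 :+ s :+ con 0)) := con 2 :+ s :* con 3) refl (s 1F))))
  bound 2F = s≤s (≤-trans (+-mono-≤ (bal 0F 2F) (+-mono-≤ (bal 1F 2F) (+-mono-≤ (≤-refl {s 2F}) z≤n)))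
    (≤-reflexive (solve 1 (λ s → con 1 :+ s :+ (con 1 :+ s :+ (s :+ con 0)) := con 2 :+ s :* con 3) refl (s 2F))))

-- Three classes of size at least `k` with total `3k` leave no slack.
completeBalanced3Partite⇒balanced : (T : Hypergraph 3 n) → n ≡ k * 3 →
                                    IsCompleteBalanced3Partite T → BalancedBlowUp K₃³ T k
completeBalanced3Partite⇒balanced {k = k} T refl P@(c , bal , _) =
  c , completeBalanced3Partite⇒blowUp T P , sizes
  where
  k≤ : ∀ i → k ≤ ∣ class c i ∣
  k≤ i = ≤-trans (≤-reflexive (sym (m*n/n≡m k 3))) (balanced-classes c bal i)
  parts : ∣ class c 0F ∣ ≡ k × ∣ class c 1F ∣ ≡ k × ∣ class c 2F ∣ ≡ k
  parts = three-parts (k≤ 0F) (k≤ 1F) (k≤ 2F) (≤-reflexive (trans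
    (cong (λ s → ∣ class c 0F ∣ + (∣ class c 1F ∣ + s)) (sym (+-identityʳ ∣ class c 2F ∣)))
    (trans (sum-classes c) (sym (m+[m+m]≡m*3 k)))))
  sizes : ∀ i → ∣ class c i ∣ ≡ k
  sizes 0F = proj₁ parts
  sizes 1F = proj₁ (proj₂ parts)
  sizes 2F = proj₂ (proj₂ parts)

equalClassBlowUp⇒balanced : (B : Hypergraph 3 n) → n ≡ k * 6 → IsEqualClassBlowUp H₆ B → BalancedBlowUp H₆ B k
equalClassBlowUp⇒balanced {k = k} B n≡6k (c , equal , b) = c , blowUpAlong⇒blowUp H₆ c B b , λ i →
  *-cancelˡ-≡ _ k 6 (trans (sum-cong-≗ {6} (λ j → equal i j)) (trans (sum-classes c) (trans n≡6k (*-comm k 6))))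

completeTripartite : (Fin n → Fin 3) → Hypergraph 3 n
completeTripartite c = record
  { Edge    = λ S → ∣ S ∣ ≡ 3 × (∀ i → ∣ S ∩ class c i ∣ ≡ 1)
  ; edge?   = λ S → (∣ S ∣ ≟ⁿ 3) ×-dec all? λ i → ∣ S ∩ class c i ∣ ≟ⁿ 1
  ; uniform = proj₁
  }

blowUp : Hypergraph 3 m → (Fin n → Fin m) → Hypergraph 3 n
blowUp F c = record
  { Edge    = λ S → ∃[ u ] ∃[ v ] ∃[ w ] (S ≡ triple u v w × Edge F (triple (c u) (c v) (c w)))
  ; edge?   = λ S → any? λ u → any? λ v → any? λ w → ≡-dec _≟ᵇ_ S (triple u v w) ×-dec edge? F _
  ; uniform = λ { (u , v , w , refl , e) → ∣triple∣
      (adj⇒u≢v F {w = c w} (adj⁺ F e) ∘ cong c) (adj⇒u≢w F {v = c v} (adj⁺ F e) ∘ cong c)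
      (adj⇒v≢w F {u = c u} (adj⁺ F e) ∘ cong c) }
  }

mod₃ : Fin n → Fin 3
mod₃ 0F = 0F
mod₃ 1F = 1F
mod₃ 2F = 2F
mod₃ (suc (suc (suc v))) = mod₃ v

mod₃-balanced : ∀ n i j → ∣ class (mod₃ {n}) i ∣ ≤ suc ∣ class (mod₃ {n}) j ∣
mod₃-balanced 0 i j = z≤n
mod₃-balanced 1 = from-yes (all? λ i → all? λ j → ∣ class (mod₃ {1}) i ∣ ≤? suc ∣ class (mod₃ {1}) j ∣)
mod₃-balanced 2 = from-yes (all? λ i → all? λ j → ∣ class (mod₃ {2}) i ∣ ≤? suc ∣ class (mod₃ {2}) j ∣)
mod₃-balanced (suc (suc (suc n))) i j =
  subst₂ (λ p q → p ≤ suc q) (sym (step i)) (sym (step j)) (s≤s (mod₃-balanced n i j))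
  where
  step : ∀ i → ∣ class (mod₃ {suc (suc (suc n))}) i ∣ ≡ suc ∣ class (mod₃ {n}) i ∣
  step 0F = refl
  step 1F = refl
  step 2F = refl

mod₆ : Fin n → Fin 6
mod₆ 0F = 0F
mod₆ 1F = 1F
mod₆ 2F = 2F
mod₆ 3F = 3F
mod₆ 4F = 4F
mod₆ 5F = 5F
mod₆ (suc (suc (suc (suc (suc (suc v)))))) = mod₆ v

mod₆-equal : ∀ k i → ∣ class (mod₆ {k * 6}) i ∣ ≡ k
mod₆-equal zero i = refl
mod₆-equal (suc k) 0F = cong suc (mod₆-equal k 0F)
mod₆-equal (suc k) 1F = cong suc (mod₆-equal k 1F)
mod₆-equal (suc k) 2F = cong suc (mod₆-equal k 2F)
mod₆-equal (suc k) 3F = cong suc (mod₆-equal k 3F)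
mod₆-equal (suc k) 4F = cong suc (mod₆-equal k 4F)
mod₆-equal (suc k) 5F = cong suc (mod₆-equal k 5F)

∃completeBalanced3Partite : ∀ n → Σ[ T ∈ Hypergraph 3 n ] IsCompleteBalanced3Partite T
∃completeBalanced3Partite n = completeTripartite mod₃ , mod₃ , mod₃-balanced n , λ S → mk⇔ idᶠ idᶠ

∃equalClassBlowUp : n ≡ k * 6 → Σ[ B ∈ Hypergraph 3 n ] IsEqualClassBlowUp H₆ B
∃equalClassBlowUp {k = k} refl = blowUp H₆ mod₆ , mod₆
  , (λ i j → trans (mod₆-equal k i) (sym (mod₆-equal k j))) , λ S → mk⇔ idᶠ idᶠ

n<3⇒no-edge : (H : Hypergraph 3 n) → n < 3 → ¬ (∃[ e ] Edge H e)
n<3⇒no-edge H n<3 (e , e∈H) = ≤⇒≯ (subst (_≤ _) (uniform H e∈H) (∣p∣≤n e)) n<3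

-- The extremal value and the extremal 3-graphs.

co⁺ex-K₄⁻ : ∀ n → IsCo⁺ex n K₄⁻ (n / 3)
co⁺ex-K₄⁻ n = (T n , K₄⁻-free⇒Free (T n) (T-free n) , T-δ⁺ n) , upper
  where
  T : ∀ n → Hypergraph 3 n
  T n = proj₁ (∃completeBalanced3Partite n)
  T-blowUp : ∀ n → BlowUp K₃³ mod₃ (T n)
  T-blowUp n = completeBalanced3Partite⇒blowUp (T n) (proj₂ (∃completeBalanced3Partite n))
  T-free : ∀ n → K₄⁻-free (T n)
  T-free n = blowUp-K₄⁻-free {F = K₃³} {mod₃} {T n} K₃³-K₄⁻-free (T-blowUp n)
  T-δ⁺ : ∀ n → Isδ⁺ (T n) (n / 3)
  -- With fewer than three vertices there is no edge, and the conventional value 0 agrees with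
  -- `n / 3`.
  T-δ⁺ 0 = inj₂ (n<3⇒no-edge (T 0) (s≤s z≤n) , refl)
  T-δ⁺ 1 = inj₂ (n<3⇒no-edge (T 1) (s≤s (s≤s z≤n)) , refl)
  T-δ⁺ 2 = inj₂ (n<3⇒no-edge (T 2) (s≤s (s≤s (s≤s z≤n))) , refl)
  T-δ⁺ n@(suc (suc (suc _))) = δ⁺≡n/3 (T n) (T-free n)
    (triple 0F 1F 2F , adj⁻ (T n) {0F} {1F} {2F} (trans (T-blowUp n 0F 1F 2F) (adj⁺ K₃³ (here refl))))
    (K₃³-codegrees {H = T n} (T-blowUp n) (balanced-classes (mod₃ {n}) (mod₃-balanced n)))
  upper : ∀ j → Σ[ H ∈ Hypergraph 3 n ] (Free K₄⁻ H × Isδ⁺ H j) → j ≤ n / 3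
  upper j (H , free , inj₁ (e , δ , _)) = δ⁺≤n/3 H (Free⇒K₄⁻-free H free) e δ
  upper j (H , free , inj₂ (_ , refl)) = z≤n

extremal⇐ : (H : Hypergraph 3 n) → K₄⁻-free H → (∃[ e ] Edge H e) → CodegreesAtLeast H (n / 3) → Extremal K₄⁻ H
extremal⇐ {n} H free e codeg = K₄⁻-free⇒Free H free , n / 3 , co⁺ex-K₄⁻ n , δ⁺≡n/3 H free e codeg

module _ {n k : ℕ} (1≤k : 1 ≤ k) (n≡k*3 : n ≡ k * 3) where

  private
    n/3≡k : n / 3 ≡ k
    n/3≡k = trans (cong (_/ 3) n≡k*3) (m*n/n≡m k 3)

  K₃³-balanced⇒extremal : {H : Hypergraph 3 n} → BalancedBlowUp K₃³ H k → Extremal K₄⁻ H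
  K₃³-balanced⇒extremal {H} bal@(c , b , sizes) = extremal⇐ H
    (blowUp-K₄⁻-free {F = K₃³} {c} {H} K₃³-K₄⁻-free b)
    (balanced-edge {F = K₃³} {H} 1≤k bal {0F} {1F} {2F} (adj⁺ K₃³ (here refl)))
    (K₃³-codegrees {H = H} b λ i → ≤-reflexive (trans n/3≡k (sym (sizes i))))

  H₆-balanced⇒extremal : ∀ {s} {H : Hypergraph 3 n} → 1 ≤ s → s + s ≡ k → BalancedBlowUp H₆ H s → Extremal K₄⁻ H
  H₆-balanced⇒extremal {s} {H} 1≤s s+s≡k bal@(c , b , _) = extremal⇐ H
    (blowUp-K₄⁻-free {F = H₆} {c} {H} H₆-K₄⁻-free b)
    (balanced-edge {F = H₆} {H} 1≤s bal {0F} {1F} {2F} (adj⁺ H₆ (here refl)))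
    (subst (CodegreesAtLeast H) (trans s+s≡k (sym n/3≡k)) (H₆-codegrees {H = H} bal))

  extremal⇒balanced : {H : Hypergraph 3 n} → Extremal K₄⁻ H →
                      BalancedBlowUp K₃³ H k ⊎ Σ[ s ∈ ℕ ] BalancedBlowUp H₆ H s
  extremal⇒balanced {H} (free , j , co⁺ex≡j , δ⁺≡j)
    -- A maximum is unique, so the value that witnesses extremality is `n / 3`, that is `k`.
    with trans (≤-antisym (proj₂ (co⁺ex-K₄⁻ n) j (proj₁ co⁺ex≡j))
                          (proj₂ co⁺ex≡j (n / 3) (proj₁ (co⁺ex-K₄⁻ n)))) n/3≡k
  ... | refl with δ⁺≡j
  ...   | inj₂ (_ , refl) = contradiction 1≤k λ ()
  ...   | inj₁ (e , δ , _) with has-edge⁻ H e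
  ...     | u , v , w , uvw = Tight.classification H (Free⇒K₄⁻-free H free) (codegrees⁺ H δ)
            (trans n≡k*3 (sym (m+[m+m]≡m*3 k))) 1≤k uvw

theorem4 : (n : ℕ) → 1 ≤ n →
    IsCo⁺ex n K₄⁻ (n / 3)
    × (n % 6 ≡ 0 →
    (Σ[ T ∈ Hypergraph 3 n ] IsCompleteBalanced3Partite T)
    × (Σ[ B ∈ Hypergraph 3 n ] IsEqualClassBlowUp H₆ B)
    × ((T B : Hypergraph 3 n) → IsCompleteBalanced3Partite T → IsEqualClassBlowUp H₆ B →
    ¬ (T ≅ B)
    × ((H : Hypergraph 3 n) → Extremal K₄⁻ H ⇔ (H ≅ T ⊎ H ≅ B))))
    × (n % 6 ≡ 3 →
    (Σ[ T ∈ Hypergraph 3 n ] IsCompleteBalanced3Partite T)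
    × ((T : Hypergraph 3 n) → IsCompleteBalanced3Partite T →
    (H : Hypergraph 3 n) → Extremal K₄⁻ H ⇔ H ≅ T))
theorem4 n 1≤n = co⁺ex-K₄⁻ n , n≡0 , n≡3
  where
  t : ℕ
  t = n / 6

  n≡0 : n % 6 ≡ 0 →
      (Σ[ T ∈ Hypergraph 3 n ] IsCompleteBalanced3Partite T)
    × (Σ[ B ∈ Hypergraph 3 n ] IsEqualClassBlowUp H₆ B)
    × ((T B : Hypergraph 3 n) → IsCompleteBalanced3Partite T → IsEqualClassBlowUp H₆ B →
        ¬ (T ≅ B) × ((H : Hypergraph 3 n) → Extremal K₄⁻ H ⇔ (H ≅ T ⊎ H ≅ B)))
  n≡0 n%6≡0 = ∃completeBalanced3Partite n , ∃equalClassBlowUp {k = t} n≡6t , λ T B isT isB →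
    let balT = completeBalanced3Partite⇒balanced T n≡3k isT
        balB = equalClassBlowUp⇒balanced B n≡6t isB
    in K₃³≇H₆ {T = T} {B} 1≤t (proj₁ balT) (proj₁ (proj₂ balT)) balB , λ H → mk⇔
        (λ ext → [ (λ bal → inj₁ (balanced-≅ {F = K₃³} {H} {T} bal balT))
                 , (λ { (s , bal) → inj₂ (balanced-≅ {F = H₆} {H} {B}
                     (subst (BalancedBlowUp H₆ H) (s≡t {s} {H} bal) bal) balB) }) ]′
                 (extremal⇒balanced 1≤k n≡3k {H} ext))
        [ (λ ψ → K₃³-balanced⇒extremal 1≤k n≡3k {H} (balanced-≅⁻ {F = K₃³} {T} {H} ψ balT))
        , (λ ψ → H₆-balanced⇒extremal 1≤k n≡3k {t} {H} 1≤t refl (balanced-≅⁻ {F = H₆} {B} {H} ψ balB)) ]′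
    where
    n≡6t : n ≡ t * 6
    n≡6t = trans (m≡m%n+[m/n]*n n 6) (cong (_+ t * 6) n%6≡0)
    -- The codegree is `2t` because in the blow-up of `H₆` two classes of size `t` complete each
    -- pair that lies in an edge.
    n≡3k : n ≡ (t + t) * 3
    n≡3k = trans n≡6t (solve 1 (λ t → t :* con 6 := (t :+ t) :* con 3) refl t)
    1≤t : 1 ≤ t
    1≤t with t | n≡6t
    ... | zero | n≡0 = contradiction (subst (1 ≤_) n≡0 1≤n) λ ()
    ... | suc _ | _ = s≤s z≤n
    1≤k : 1 ≤ t + t
    1≤k = ≤-trans 1≤t (m≤m+n t t)
    s≡t : ∀ {s} {H : Hypergraph 3 n} → BalancedBlowUp H₆ H s → s ≡ t
    s≡t {s} {H} bal = *-cancelˡ-≡ s t 6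
      (trans (sym (balanced⇒n≡ {F = H₆} {H} bal)) (trans n≡6t (*-comm t 6)))

  n≡3 : n % 6 ≡ 3 →
      (Σ[ T ∈ Hypergraph 3 n ] IsCompleteBalanced3Partite T)
    × ((T : Hypergraph 3 n) → IsCompleteBalanced3Partite T →
        (H : Hypergraph 3 n) → Extremal K₄⁻ H ⇔ H ≅ T)
  n≡3 n%6≡3 = ∃completeBalanced3Partite n , λ T isT H →
    let balT = completeBalanced3Partite⇒balanced T n≡3k isT in mk⇔
      (λ ext → [ (λ bal → balanced-≅ {F = K₃³} {H} {T} bal balT)
               , (λ { (s , bal) → contradiction (trans (sym n%6≡3) (n%6≡0 {s} {H} bal)) λ () }) ]′
               (extremal⇒balanced 1≤k n≡3k {H} ext))
      (λ ψ → K₃³-balanced⇒extremal 1≤k n≡3k {H} (balanced-≅⁻ {F = K₃³} {T} {H} ψ balT))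
    where
    1≤k : 1 ≤ suc (t + t)
    1≤k = s≤s z≤n
    n≡3k : n ≡ suc (t + t) * 3
    n≡3k = trans (m≡m%n+[m/n]*n n 6) (trans (cong (_+ t * 6) n%6≡3)
      (solve 1 (λ t → con 3 :+ t :* con 6 := (con 1 :+ (t :+ t)) :* con 3) refl t))
    -- Six equal classes would make `n` a multiple of 6, which rules out the blow-up of `H₆` here.
    n%6≡0 : ∀ {s} {H : Hypergraph 3 n} → BalancedBlowUp H₆ H s → n % 6 ≡ 0
    n%6≡0 {s} {H} bal = trans (cong (_% 6) (trans (balanced⇒n≡ {F = H₆} {H} bal) (*-comm 6 s))) (m*n%n≡0 s 6)
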